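{- There exists an absolute constant $C$ such that for every tree $T$ with $n$ vertices and diameter $d$, $$\mu_T\le n-\log_2 n-2\log_2(n-d)+C.$$
   Context: A subtree of a tree $T$ is a (nonempty) induced connected subgraph; the mean subtree order $\mu_T$ is the average number of vertices of a subtree of $T$, averaged over all subtrees. The diameter $d$ is the maximum number of edges of a path in $T$ (so $d\le n-1$). -}

module Defs where

open import Level using (0ℓ)
open import Data.Nat using (ℕ; suc; _+_; _*_; _∸_; _^_; _≤_)
open import Data.Fin using (Fin)
open import Data.Fin.Subset as Sub using (Subset; ∣_∣; Nonempty)
open import Data.List using (List; []; _∷_; length; map)
open import Data.Nat.ListAction using (sum)
open import Data.List.Relation.Unary.All using (All)
open import Data.List.Relation.Unary.Unique.Propositional using (Unique)
open import Data.Product using (Σ; ∃; ∃-syntax; _×_)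
open import Relation.Nullary using (¬_)
open import Relation.Binary.PropositionalEquality using (_≡_)

record Graph (n : ℕ) : Set₁ where
  field
    Adj    : Fin n → Fin n → Set
    sym    : ∀ {u v} → Adj u v → Adj v u
    irrefl : ∀ {u} → ¬ Adj u u
open Graph public

module _ {n : ℕ} (G : Graph n) where

  data Walk : Fin n → Fin n → List (Fin n) → Set where
    single : ∀ u → Walk u u (u ∷ [])
    step   : ∀ {u v w vs} → Adj G u v → Walk v w vs → Walk u w (u ∷ vs)

  -- A path: a walk with no repeated vertices. Its number of edges is length vs ∸ 1.
  Path : Fin n → Fin n → List (Fin n) → Set
  Path u v vs = Walk u v vs × Unique vs

  HasCycle : Set
  HasCycle = ∃[ u ] ∃[ w ] ∃[ vs ] (Path u w vs × 3 ≤ length vs × Adj G w u)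

  Connected : Set
  Connected = ∀ u v → ∃[ vs ] Walk u v vs

  IsTree : Set
  IsTree = Connected × ¬ HasCycle

  IsDiameter : ℕ → Set
  IsDiameter d = (∃[ u ] ∃[ v ] ∃[ vs ] (Path u v vs × length vs ∸ 1 ≡ d))
               × (∀ u v vs → Path u v vs → length vs ∸ 1 ≤ d)

  IsSubtree : Subset n → Set
  IsSubtree S = Nonempty S
              × (∀ u v → u Sub.∈ S → v Sub.∈ S →
                   ∃[ vs ] (Walk u v vs × All (Sub._∈ S) vs))

totalOrder : ∀ {n} → List (Subset n) → ℕ
totalOrder L = sum (map ∣_∣ L)

{-# OPTIONS --safe #-}

-- Write D for the average number of vertices missing from a subtree; the claim is that
-- D ≥ log₂ n + 2 log₂ (n − d) − C. By Jamison's inequality D may be averaged over the subtrees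
-- containing a root r of our choice. Such subtrees factor over the branches at r, so this local D is
-- additive over branches and does not decrease when a new root is put on top. A branch of height h
-- with N rooted subtrees satisfies 2D ≥ log₂ N + h²/(2N) − O(1), which is at least 2 log₂ h − O(1)
-- whatever N is. Hence D is at least the sum of log₂ (height) − O(1) over disjoint branches.
--
-- Take r at the centre, let h₁, h₂ be the heights of its two tallest branches (so d ≥ h₁ + h₂), and let
-- m = n − h₁ − h₂ count the root and the vertices off the corresponding path. If m² is at most about n,
-- the two branches give D ≥ 2 log₂ n − O(1). Otherwise put s = 2^j with j about (log₂ n) / 4, and
-- suppose D < 3 log₂ n. The tree has at most 2D leaves, and it contains at most D / (j − 1) disjoint
-- branches of height s, which is bounded; so the branches hanging off the path have m ≤ 30 o vertices,
-- where o is their maximal height. A tallest one, together with the two ends of the path,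
-- gives D ≥ log₂ n + 2 log₂ o − O(1).

module Submission where

open import Defs
open import Data.Nat
open import Data.Nat.Properties
open import Data.Nat.ListAction using (sum)
open import Data.Nat.ListAction.Properties using (sum-++; sum-↭)
open import Data.Nat.Tactic.RingSolver using (solve-∀)
open import Data.Fin using (Fin; fromℕ<)
open import Data.Fin.Properties using (any?) renaming (_≟_ to _≟ᶠ_)
open import Data.Fin.Subset
  using (Subset; ∣_∣; ⁅_⁆; _∪_; _∩_; ⊥; ⊤; Nonempty; _⊆_; inside; outside)
  renaming (_∈_ to _∈ₛ_; _∉_ to _∉ₛ_)
open import Data.Fin.Subset.Properties
  using (_∈?_; ∈⊤; ∉⊥; x∈⁅x⁆; x∈⁅y⁆⇒x≡y; x∈p∪q⁺; x∈p∪q⁻; x∈p∩q⁺; x∈p∩q⁻; p∩q⊆p; p∩q⊆q;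
         ⊆-antisym; ∪-assoc; ∪-comm; ∩-distribˡ-∪; ∣⊥∣≡0; ∣⊤∣≡n; ∣⁅x⁆∣≡1; ∣p∣≤n; ∣p∣≡n⇒p≡⊤;
         Empty-unique)
open import Data.List using (List; []; _∷_; _++_; length; map; cartesianProductWith)
open import Data.List.Properties using (length-++; length-map; map-++)
open import Data.List.Membership.Propositional using (_∈_)
open import Data.List.Membership.Propositional.Properties
  using (∈-++⁺ˡ; ∈-++⁺ʳ; ∈-++⁻; ∈-map⁻; ∈-cartesianProductWith⁺; ∈-cartesianProductWith⁻)
open import Data.List.Membership.Propositional.Properties.WithK using (unique∧set⇒bag)
open import Data.List.Relation.Binary.BagAndSetEquality using (∼bag⇒↭)
open import Data.List.Relation.Binary.Permutation.Propositional using (_↭_)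
open import Data.List.Relation.Binary.Permutation.Propositional.Properties using (map⁺; ↭-length)
open import Data.List.Relation.Unary.Any using (here; there)
open import Data.List.Relation.Unary.All as All using (All; []; _∷_)
import Data.List.Relation.Unary.All.Properties as All
open import Data.List.Relation.Unary.AllPairs using ([]; _∷_)
open import Data.List.Relation.Unary.Unique.Propositional using (Unique)
import Data.List.Relation.Unary.Unique.Propositional.Properties as Unique
open import Data.Vec using ([]; _∷_; here; there)
open import Data.Product using (_×_; _,_; proj₁; proj₂; ∃-syntax)
open import Data.Sum using (_⊎_; inj₁; inj₂; [_,_]′)
open import Function using (_∘_; id; case_of_; _⟨_⟩_)
open import Function.Bundles using (_⇔_; mk⇔)
open import Function.Properties.Equivalence using () renaming (sym to ⇔-sym; trans to ⇔-trans)
open import Relation.Nullary using (¬_; Dec; yes; no; contradiction)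
open import Relation.Nullary.Decidable using (decidable-stable; ¬?; map′)
open import Relation.Binary.PropositionalEquality as ≡ hiding (sym)

-- Linear-arithmetic certificate: y − x = (q − p) + s.
certify : ∀ {x y p q} s → p ≤ q → x + q + s ≡ y + p → x ≤ y
certify {x} {y} {p} {q} s p≤q eq = +-cancelʳ-≤ q x y (begin
  x + q      ≤⟨ m≤m+n (x + q) s ⟩
  x + q + s  ≡⟨ eq ⟩
  y + p      ≤⟨ +-monoʳ-≤ y p≤q ⟩
  y + q      ∎)
  where open ≤-Reasoning

-- Profiles of rooted trees

-- For a rooted tree: count is the number of subtrees containing the root, and missing is the
-- number of pairs of such a subtree and a vertex outside it.
record Profile : Set where
  constructor profile
  field height edges count missing : ℕ

open Profile

single-vertex : Profile
single-vertex = profile 0 0 1 0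

-- A new root above the old one; the subtree consisting of the new root alone is new.
plant : Profile → Profile
plant (profile h e N M) = profile (suc h) (suc e) (suc N) (M + suc e)

-- Gluing two rooted trees at their roots.
_⊕_ : Profile → Profile → Profile
profile h e N M ⊕ profile h′ e′ N′ M′ = profile (h ⊔ h′) (e + e′) (N * N′) (N′ * M + N * M′)

infixr 5 _⊕_

-- The entropy inequality under planting and gluing

tri : ℕ → ℕ
tri zero    = 0
tri (suc h) = tri h + h

-- x ↦ max_K ((2 + K) x − 2^(K+1)) is the piecewise linear function that agrees with x log₂ x at
-- the powers of two, so this says that 2M ≥ N log₂ N + h(h−1)/2 in a form free of logarithms.
Entropic : Profile → Set
Entropic (profile h _ N M) = ∀ K → (2 + K) * N + tri h ≤ 2 * M + 2 ^ suc K

-- Selects which linear pieces of the two factors produce the piece of index `K` for `N₁ * N₂`. In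
-- `below` and `above` the differences `N₁ - 2 ^ K₁` and `N₂ - 2 ^ K₂` have the same sign. In
-- `between` this holds after raising both exponents by one, and the indices sum to `K - 1`.
data Split (N₁ N₂ : ℕ) : ℕ → Set where
  below   : ∀ K₁ K₂ → 2 ^ K₁ ≤ N₁ → 2 ^ K₂ ≤ N₂ → Split N₁ N₂ (K₁ + K₂)
  between : ∀ K₁ K₂ → 2 ^ K₁ ≤ N₁ → 2 ^ K₂ ≤ N₂ → N₁ ≤ 2 ^ suc K₁ → N₂ ≤ 2 ^ suc K₂ →
            Split N₁ N₂ (suc (K₁ + K₂))
  above   : ∀ K₁ K₂ → N₁ ≤ 2 ^ K₁ → N₂ ≤ 2 ^ K₂ → Split N₁ N₂ (K₁ + K₂)

-- As `K` grows, raise an exponent whose power still fits below its factor. When neither can be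
-- raised, one step through `between` leads to `above`, which persists.
split : ∀ {N₁ N₂} → 1 ≤ N₁ → 1 ≤ N₂ → ∀ K → Split N₁ N₂ K
split p q zero = below 0 0 p q
split {N₁} {N₂} p q (suc K) with split p q K
... | between K₁ K₂ _ _ c d = subst (Split N₁ N₂) (cong suc (+-suc K₁ K₂))
      (above (suc K₁) (suc K₂) c d)
... | above K₁ K₂ a b = above (suc K₁) K₂ (≤-trans a (^-monoʳ-≤ 2 (n≤1+n K₁))) b
... | below K₁ K₂ a b with 2 ^ suc K₁ ≤? N₁ | 2 ^ suc K₂ ≤? N₂
...   | yes c | _     = below (suc K₁) K₂ c b
...   | no _  | yes d = subst (Split N₁ N₂) (+-suc K₁ K₂) (below K₁ (suc K₂) a d)
...   | no c  | no d  = between K₁ K₂ a b (<⇒≤ (≰⇒> c)) (<⇒≤ (≰⇒> d))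

rearrange : ∀ {a b x y} → a ≤ x → b ≤ y → a * y + b * x ≤ x * y + a * b
rearrange {a} {b} a≤x b≤y with x , refl ← m≤n⇒∃[o]m+o≡n a≤x | y , refl ← m≤n⇒∃[o]m+o≡n b≤y =
  ≤-trans (m≤m+n _ (x * y)) (≤-reflexive (lem a b x y))
  where
  lem : ∀ a b x y → a * (b + y) + b * (a + x) + x * y ≡ (a + x) * (b + y) + a * b
  lem = solve-∀

tri-⊔ : ∀ {a b N₁ N₂} → 1 ≤ N₁ → 1 ≤ N₂ → tri (a ⊔ b) ≤ N₂ * tri a + N₁ * tri b
tri-⊔ {a} {b} {N₁} {N₂} p q with ⊔-sel a b
... | inj₁ eq rewrite eq = ≤-trans (m≤n*m (tri a) N₂ {{>-nonZero q}}) (m≤m+n _ _)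
... | inj₂ eq rewrite eq = ≤-trans (m≤n*m (tri b) N₁ {{>-nonZero p}}) (m≤n+m _ _)

entropic-single : Entropic single-vertex
entropic-single zero    = ≤-refl
entropic-single (suc K) = ≤-trans (+-mono-≤ (m^n>0 2 (suc K)) (entropic-single K))
  (≤-reflexive (cong (2 ^ suc K +_) (≡.sym (+-identityʳ _))))

-- Planting adds `2 + K + h` on the left and `2 * (e + 1)` on the right, which settles `K ≤ e`.
-- Beyond that, raising `K` by one costs `N + 1` on the left and gains `2 ^ suc K` on the right, and
-- `N ≤ 2 ^ e ≤ 2 ^ K`.
entropic-plant : ∀ p → Entropic p → count p ≤ 2 ^ edges p → height p ≤ edges p → Entropic (plant p)
entropic-plant p@(profile h e N M) H N≤ h≤e = go
  where
  low : ∀ K → K ≤ e → (2 + K) * suc N + tri (suc h) ≤ 2 * (M + suc e) + 2 ^ suc K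
  low K K≤e = certify 0 (+-mono-≤ (H K) (+-mono-≤ K≤e h≤e))
    (lem K N (tri h) h M e (2 ^ suc K))
    where
    lem : ∀ K N t h M e A →
      (2 + K) * suc N + (t + h) + (2 * M + A + (e + e)) + 0 ≡
      2 * (M + suc e) + A + ((2 + K) * N + t + (K + h))
    lem = solve-∀
  go : Entropic (plant p)
  go zero    = low 0 z≤n
  go (suc K) with suc K ≤? e
  ... | yes p = low (suc K) p
  ... | no ¬p = certify 0 (+-mono-≤ (go K) N<)
    (lem K N (tri (suc h)) (2 * (M + suc e)) (2 ^ K))
    where
    lem : ∀ K N t M A →
      (3 + K) * suc N + t + (M + 2 * A + (A + A)) + 0 ≡
      M + 2 * (2 * A) + ((2 + K) * suc N + t + (1 + N))
    lem = solve-∀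
    N< : 1 + N ≤ 2 ^ K + 2 ^ K
    N< = +-mono-≤ (m^n>0 2 K) (≤-trans N≤ (^-monoʳ-≤ 2 (≤-pred (≰⇒> ¬p))))

-- `combined` adds the inequality of each factor, multiplied by the count of the other. `rearrange`
-- then bounds the cross terms `2 ^ K₁ * N₂ + 2 ^ K₂ * N₁`. This costs `2 * P` when the powers lie
-- on the same side and only `P` in `between`, where `K` is larger by one.
entropic-⊕ : ∀ p q → 1 ≤ count p → 1 ≤ count q → Entropic p → Entropic q → Entropic (p ⊕ q)
entropic-⊕ (profile a _ N₁ M₁) (profile b _ N₂ M₂) p q H₁ H₂ K = go (split p q K)
  where
  P M t : ℕ
  P = N₁ * N₂
  M = N₂ * M₁ + N₁ * M₂
  t = tri (a ⊔ b)

  combined : ∀ K₁ K₂ → (4 + (K₁ + K₂)) * P + t ≤ 2 * M + 2 * (2 ^ K₁ * N₂ + 2 ^ K₂ * N₁)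
  combined K₁ K₂ = certify 0
    (+-mono-≤ (+-mono-≤ (*-monoʳ-≤ N₂ (H₁ K₁)) (*-monoʳ-≤ N₁ (H₂ K₂))) (tri-⊔ {a} {b} p q))
    (lem K₁ K₂ N₁ N₂ M₁ M₂ t (tri a) (tri b) (2 ^ K₁) (2 ^ K₂))
    where
    lem : ∀ K₁ K₂ N₁ N₂ M₁ M₂ t u v A B →
      (4 + (K₁ + K₂)) * (N₁ * N₂) + t
        + (N₂ * (2 * M₁ + 2 * A) + N₁ * (2 * M₂ + 2 * B) + (N₂ * u + N₁ * v)) + 0
      ≡ 2 * (N₂ * M₁ + N₁ * M₂) + 2 * (A * N₂ + B * N₁)
        + (N₂ * ((2 + K₁) * N₁ + u) + N₁ * ((2 + K₂) * N₂ + v) + t)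
    lem = solve-∀

  same-side : ∀ K₁ K₂ → 2 ^ K₁ * N₂ + 2 ^ K₂ * N₁ ≤ P + 2 ^ K₁ * 2 ^ K₂ →
              (2 + (K₁ + K₂)) * P + t ≤ 2 * M + 2 ^ suc (K₁ + K₂)
  same-side K₁ K₂ r rewrite ^-distribˡ-+-* 2 K₁ K₂ =
    certify 0 (+-mono-≤ (combined K₁ K₂) (*-monoʳ-≤ 2 r))
      (lem (K₁ + K₂) P M t (2 ^ K₁ * N₂ + 2 ^ K₂ * N₁) (2 ^ K₁ * 2 ^ K₂))
    where
    lem : ∀ K P M t S AB → (2 + K) * P + t + (2 * M + 2 * S + 2 * (P + AB)) + 0
                         ≡ 2 * M + 2 * AB + ((4 + K) * P + t + 2 * S)
    lem = solve-∀

  go : Split N₁ N₂ K → (2 + K) * P + t ≤ 2 * M + 2 ^ suc K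
  go (below K₁ K₂ c d) = same-side K₁ K₂ (rearrange c d)
  go (above K₁ K₂ c d) = same-side K₁ K₂ (certify 0 (rearrange c d) (lem N₁ N₂ (2 ^ K₁) (2 ^ K₂)))
    where
    lem : ∀ N₁ N₂ A B →
      A * N₂ + B * N₁ + (A * B + N₁ * N₂) + 0 ≡ N₁ * N₂ + A * B + (N₁ * B + N₂ * A)
    lem = solve-∀
  go (between K₁ K₂ _ _ c d) rewrite ^-distribˡ-+-* 2 K₁ K₂ =
    certify 0 (+-mono-≤ (combined K₁ K₂) (rearrange c d))
      (lem (K₁ + K₂) N₁ N₂ M t (2 ^ K₁) (2 ^ K₂))
    where
    lem : ∀ K N₁ N₂ M t A B →
      (3 + K) * (N₁ * N₂) + t
        + (2 * M + 2 * (A * N₂ + B * N₁) + ((2 * A) * (2 * B) + N₁ * N₂)) + 0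
      ≡ 2 * M + 2 * (2 * (A * B))
        + ((4 + K) * (N₁ * N₂) + t + (N₁ * (2 * B) + N₂ * (2 * A)))
    lem = solve-∀

-- Elementary bounds for profiles

record Regular (p : Profile) : Set where
  field
    edges<count          : edges p < count p
    count≤2^edges        : count p ≤ 2 ^ edges p
    missing≤edges*count  : missing p ≤ edges p * count p
    height≤edges         : height p ≤ edges p
    entropic             : Entropic p

  count≥1 : 1 ≤ count p
  count≥1 = ≤-trans (s≤s z≤n) edges<count

open Regular

regular-single : Regular single-vertex
regular-single = record
  { edges<count = ≤-refl ; count≤2^edges = ≤-refl ; missing≤edges*count = z≤n
  ; height≤edges = z≤n ; entropic = entropic-single }

regular-plant : ∀ {p} → Regular p → Regular (plant p)
regular-plant {p@(profile h e N M)} r = record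
  { edges<count         = s≤s (edges<count r)
  ; count≤2^edges       = ≤-trans (+-mono-≤ (m^n>0 2 e) (count≤2^edges r))
                                  (≤-reflexive (cong (2 ^ e +_) (≡.sym (+-identityʳ _))))
  ; missing≤edges*count = certify N (missing≤edges*count r) (lem e N M)
  ; height≤edges        = s≤s (height≤edges r)
  ; entropic            = entropic-plant p (entropic r) (count≤2^edges r) (height≤edges r) }
  where
  lem : ∀ e N M → M + suc e + e * N + N ≡ suc e * suc N + M
  lem = solve-∀

regular-⊕ : ∀ {p q} → Regular p → Regular q → Regular (p ⊕ q)
regular-⊕ {p@(profile h e N M)} {q@(profile h′ e′ N′ M′)} r r′ = record
  { edges<count         = certify (e * e′) (*-mono-≤ (edges<count r) (edges<count r′))
                            (lem₁ e e′ (N * N′))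
  ; count≤2^edges       = ≤-trans (*-mono-≤ (count≤2^edges r) (count≤2^edges r′))
                            (≤-reflexive (≡.sym (^-distribˡ-+-* 2 e e′)))
  ; missing≤edges*count = certify 0 (+-mono-≤ (*-monoʳ-≤ N′ (missing≤edges*count r))
                                              (*-monoʳ-≤ N (missing≤edges*count r′)))
                            (lem₂ e e′ N N′ (N′ * M + N * M′))
  ; height≤edges        = ⊔-lub (m≤n⇒m≤n+o e′ (height≤edges r)) (m≤n⇒m≤o+n e (height≤edges r′))
  ; entropic            = entropic-⊕ p q (count≥1 r) (count≥1 r′) (entropic r) (entropic r′) }
  where
  lem₁ : ∀ e f P → suc (e + f) + P + e * f ≡ P + suc e * suc f
  lem₁ = solve-∀
  lem₂ : ∀ e f N K M → M + (K * (e * N) + N * (f * K)) + 0 ≡ (e + f) * (N * K) + M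
  lem₂ = solve-∀

-- Lower bounds for the local average

-- The average of the missing vertices over the subtrees containing the root is at least x / y.
infix 4 _⊩_over_

record _⊩_over_ (p : Profile) (x y : ℕ) : Set where
  constructor average≥
  field bound : x * count p ≤ y * missing p

⊩-⊕ : ∀ {p q x x′ y} → p ⊩ x over y → q ⊩ x′ over y → p ⊕ q ⊩ x + x′ over y
⊩-⊕ {profile _ _ N M} {profile _ _ N′ M′} {x} {x′} {y} (average≥ a) (average≥ b) =
  average≥ (certify 0 (+-mono-≤ (*-monoʳ-≤ N′ a) (*-monoʳ-≤ N b)) (lem x x′ y N N′ M M′))
  where
  lem : ∀ x x′ y N N′ M M′ → (x + x′) * (N * N′) + (N′ * (y * M) + N * (y * M′)) + 0
                           ≡ y * (N′ * M + N * M′) + (N′ * (x * N) + N * (x′ * N′))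
  lem = solve-∀

⊩-zero : ∀ {p y} → p ⊩ 0 over y
⊩-zero = average≥ z≤n

-- The only new subtree misses `e + 1` vertices, while `x / y` is at most `e` because no old subtree
-- misses more than `e`.
⊩-plant : ∀ {p x y} → Regular p → p ⊩ x over y → plant p ⊩ x over y
⊩-plant {p@(profile _ e N M)} {x} {y} r (average≥ a) =
  average≥ (certify y (+-mono-≤ a x≤y*e) (lem x y e N M))
  where
  instance _ = >-nonZero (count≥1 r)
  x≤y*e : x ≤ y * e
  x≤y*e = *-cancelʳ-≤ x (y * e) N (≤-trans a (≤-trans (*-monoʳ-≤ y (missing≤edges*count r))
    (≤-reflexive (≡.sym (*-assoc y e N)))))
  lem : ∀ x y e N M → x * suc N + (y * M + y * e) + y ≡ y * (M + suc e) + (x * N + x)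
  lem = solve-∀

⊩-weaken : ∀ {p x x′ y y′} → x′ ≤ x → y ≤ y′ → p ⊩ x over y → p ⊩ x′ over y′
⊩-weaken {p} x≤ y≤ (average≥ a) =
  average≥ (≤-trans (*-monoˡ-≤ (count p) x≤) (≤-trans a (*-monoˡ-≤ (missing p) y≤)))

-- The mediant of two lower bounds for the same average. It lets a bound proportional to the number
-- of edges absorb one more edge.
⊩-add : ∀ {p x x′ y y′} → p ⊩ x over y → p ⊩ x′ over y′ → p ⊩ x + x′ over y + y′
⊩-add {profile _ _ N M} {x} {x′} {y} {y′} (average≥ a) (average≥ b) =
  average≥ (certify 0 (+-mono-≤ a b) (lem x x′ y y′ N M))
  where
  lem : ∀ x x′ y y′ N M → (x + x′) * N + (y * M + y′ * M) + 0 ≡ (y + y′) * M + (x * N + x′ * N)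
  lem = solve-∀

⊩-scale : ∀ {p x y} b → p ⊩ x over y → p ⊩ b * x over b * y
⊩-scale {profile _ _ N M} {x} {y} b (average≥ a) = average≥ (begin
  b * x * N    ≡⟨ *-assoc b x N ⟩
  b * (x * N)  ≤⟨ *-monoʳ-≤ b a ⟩
  b * (y * M)  ≡⟨ *-assoc b y M ⟨
  b * y * M    ∎)
  where open ≤-Reasoning

⊕-comm : ∀ p q → p ⊕ q ≡ q ⊕ p
⊕-comm (profile h e N M) (profile h′ e′ N′ M′)
  rewrite ⊔-comm h h′ | +-comm e e′ | *-comm N N′ | +-comm (N′ * M) (N * M′) = refl

-- The contribution of a tall branch

2tri : ∀ h → 2 * tri h + h ≡ h * h
2tri zero    = refl
2tri (suc h) = trans (lem h (tri h)) (cong (λ z → z + (h + suc h)) (2tri h) ⟨ trans ⟩ lem′ h)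
  where
  lem : ∀ h t → 2 * (t + h) + suc h ≡ 2 * t + h + (h + suc h)
  lem = solve-∀
  lem′ : ∀ h → h * h + (h + suc h) ≡ suc h * suc h
  lem′ = solve-∀

tri-mono : ∀ {g h} → g ≤ h → tri g ≤ tri h
tri-mono z≤n       = z≤n
tri-mono (s≤s g≤h) = +-mono-≤ (tri-mono g≤h) g≤h

-- `tri (2 * a)` is `a * (2 * a - 1)`, which is at least `a * a` once `1 ≤ a`.
square≤tri : ∀ {a h} → 1 ≤ a → 2 * a ≤ h → a * a ≤ tri h
square≤tri {a} {h} 1≤a 2a≤h = ≤-trans (*-cancelˡ-≤ 2 (begin
    2 * (a * a)
      ≤⟨ certify 0 (*-monoʳ-≤ (2 * a) 1≤a) (lem a (2 * tri (2 * a)) (2tri (2 * a))) ⟩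
    2 * tri (2 * a)  ∎)) (tri-mono 2a≤h)
  where
  open ≤-Reasoning
  lem′ : ∀ a → 2 * (a * a) + 2 * a * a + 0 ≡ 2 * a * (2 * a)
  lem′ = solve-∀
  lem″ : ∀ a t → t + 2 * a ≡ t + 2 * a * 1
  lem″ = solve-∀
  lem : ∀ a t → t + 2 * a ≡ 2 * a * (2 * a) → 2 * (a * a) + 2 * a * a + 0 ≡ t + 2 * a * 1
  lem a t eq = trans (lem′ a) (trans (≡.sym eq) (lem″ a t))

-- Entropic at K = 2j − 3, where 2^(K+1) ≤ h(h−1)/2.
log-height : ∀ {p} → Regular p → ∀ j → 2 ^ j ≤ height p → p ⊩ j ∸ 1 over 1
log-height r 0 _ = ⊩-zero
log-height r 1 _ = ⊩-zero
log-height {p@(profile h e N M)} r (suc (suc i)) 2^j≤h = average≥ (*-cancelˡ-≤ 2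
  (certify N (+-mono-≤ (entropic r (suc (i + i))) (square≤tri (m^n>0 2 (suc i)) 2^j≤h))
    (lem i N M (2 ^ i) (2 ^ (i + i)) (tri h) (^-distribˡ-+-* 2 i i))))
  where
  lem′ : ∀ i N M A t →
    2 * (suc i * N) + (2 * M + 2 * (2 * (A * A)) + t) + N
    ≡ 2 * (1 * M) + ((3 + (i + i)) * N + t + 2 * A * (2 * A))
  lem′ = solve-∀
  lem : ∀ i N M A B t → B ≡ A * A →
    2 * (suc i * N) + (2 * M + 2 * (2 * B) + t) + N
    ≡ 2 * (1 * M) + ((3 + (i + i)) * N + t + 2 * A * (2 * A))
  lem i N M A _ t refl = lem′ i N M A t

-- Counting edges by leaves and by tall branches

-- The denominator of `sparse` at height `2 ^ j`, multiplied by `j ∸ 1`. It pays for the branches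
-- too short for `log-height`.
scale : ℕ → ℕ
scale j = 2 * (2 ^ j * (j ∸ 1))

-- A path of length h ending at the root, with r edges off the path;
-- the branches hanging off the path have height at most o.
Spine : Profile → Set
Spine p = ∃[ o ] ∃[ r ] (o ≤ height p × edges p ≡ height p + r
  × (∀ i → 2 ^ i ≤ o → p ⊩ (i ∸ 1) + (i ∸ 1) over 1)
  × (∀ j → p ⊩ (j ∸ 1) * r over o + scale j))

-- `sparse` reflects that every leaf contributes at least 1/2 and accounts for at most `H` edges.
-- `coarse` replaces leaves by branches of height `2 ^ j`, each contributing `j ∸ 1`. Any upper
-- bound `H` on the height is allowed, so that branches of different heights can be added over one
-- denominator.
record Good (p : Profile) : Set where
  field
    regular : Regular p
    sparse  : ∀ {H} → height p ≤ H → p ⊩ edges p over 2 * H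
    coarse  : ∀ j {H} → height p ≤ H → p ⊩ (j ∸ 1) * edges p over H + scale j
    spine   : Spine p

open Good

good-single : Good single-vertex
good-single = record
  { regular = regular-single
  ; sparse  = λ _ → ⊩-zero
  ; coarse  = λ j _ → zero-multiple j
  ; spine   = 0 , 0 , z≤n , refl , (λ i 2^i≤0 → contradiction 2^i≤0 (<⇒≱ (m^n>0 2 i)))
            , λ j → zero-multiple j }
  where
  zero-multiple : ∀ j {y} → single-vertex ⊩ (j ∸ 1) * 0 over y
  zero-multiple j = ⊩-weaken (≤-reflexive (*-zeroʳ (j ∸ 1))) ≤-refl ⊩-zero

-- At `K = 0` the entropy inequality says that `missing` is at least `count - 1`, and a planted tree
-- has at least two rooted subtrees.
plant-half : ∀ {p} → Regular p → plant p ⊩ 1 over 2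
plant-half {p@(profile h e N M)} r =
  average≥ (certify (tri (suc h)) (+-mono-≤ (entropic (regular-plant r) 0) (count≥1 r))
    (lem N (M + suc e) (tri (suc h))))
  where
  lem : ∀ N M t → 1 * suc N + (2 * M + 2 + N) + t ≡ 2 * M + (2 * suc N + t + 1)
  lem = solve-∀

good-plant : ∀ {p} → Good p → Good (plant p)
good-plant {p@(profile h e N M)} g = record
  { regular = regular-plant (regular g)
  ; sparse  = sparse⁺
  ; coarse  = coarse⁺
  ; spine   = spine⁺ (spine g) }
  where
  p⁺ = plant p

  planted : ∀ {x y} → p ⊩ x over y → p⁺ ⊩ x over y
  planted = ⊩-plant (regular g)

  sparse⁺ : ∀ {H} → suc h ≤ H → p⁺ ⊩ suc e over 2 * H
  sparse⁺ {H} h<H = ⊩-weaken ≤-refl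
    (≤-trans (≤-reflexive (≡.sym (*-suc 2 h))) (*-monoʳ-≤ 2 h<H))
    (⊩-add (plant-half (regular g)) (planted (sparse g ≤-refl)))

  coarse⁺ : ∀ j {H} → suc h ≤ H → p⁺ ⊩ (j ∸ 1) * suc e over H + scale j
  coarse⁺ j {H} h<H with 2 ^ j ≤? h
  -- The branch contributes `j ∸ 1` by its height, so the mediant covers the new edge at the cost of
  -- one unit of `H`.
  ... | yes tall = ⊩-weaken (≤-reflexive (*-suc (j ∸ 1) e)) (+-monoˡ-≤ (scale j) h<H)
      (⊩-add (planted (log-height (regular g) j tall)) (planted (coarse g j ≤-refl)))
  -- All heights are now at most `2 ^ j`, and `sparse` multiplied by `j ∸ 1` has denominator exactly
  -- `scale j`.
  ... | no short = ⊩-weaken ≤-refl (≤-trans (≤-reflexive (lem (j ∸ 1) (2 ^ j))) (m≤n+m _ H))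
      (⊩-scale (j ∸ 1) (sparse⁺ (≰⇒> short)))
    where
    lem : ∀ b s → b * (2 * s) ≡ 2 * (s * b)
    lem = solve-∀

  spine⁺ : Spine p → Spine p⁺
  spine⁺ (o , r , o≤h , eq , tripod , off) =
    o , r , m≤n⇒m≤1+n o≤h , cong suc eq
    , (λ i 2^i≤o → planted (tripod i 2^i≤o)) , (λ j → planted (off j))

m≤n⊔o⇒m≤n⊎m≤o : ∀ {m} n o → m ≤ n ⊔ o → m ≤ n ⊎ m ≤ o
m≤n⊔o⇒m≤n⊎m≤o n o m≤ with ⊔-sel n o
... | inj₁ eq = inj₁ (≤-trans m≤ (≤-reflexive eq))
... | inj₂ eq = inj₂ (≤-trans m≤ (≤-reflexive eq))

-- The path of the taller tree `p` is kept, and all of `q` goes off the path, where `coarse`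
-- measures it. If `q` sets the new height `o`, then `p` is at least as tall, so `p` and `q` are two
-- disjoint branches contributing `i ∸ 1` each.
spine-⊕ : ∀ p q → Good p → Good q → height q ≤ height p → Spine (p ⊕ q)
spine-⊕ p q g g′ h′≤h with o , r , o≤h , eq , tripod , off ← spine g =
  o ⊔ height q , r + edges q
  , ≤-trans (⊔-lub o≤h h′≤h) (≤-reflexive (≡.sym h≡))
  , trans (cong (_+ edges q) eq)
      (trans (+-assoc (height p) r (edges q)) (cong (_+ (r + edges q)) (≡.sym h≡)))
  , tripod′ , off′
  where
  h≡ : height (p ⊕ q) ≡ height p
  h≡ = m≥n⇒m⊔n≡m h′≤h
  tripod′ : ∀ i → 2 ^ i ≤ o ⊔ height q → p ⊕ q ⊩ (i ∸ 1) + (i ∸ 1) over 1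
  tripod′ i 2^i≤ with m≤n⊔o⇒m≤n⊎m≤o o (height q) 2^i≤
  ... | inj₁ a = ⊩-weaken (m≤m+n _ 0) ≤-refl (⊩-⊕ (tripod i a) ⊩-zero)
  ... | inj₂ a = ⊩-⊕ (log-height (regular g) i (≤-trans a h′≤h)) (log-height (regular g′) i a)
  off′ : ∀ j → p ⊕ q ⊩ (j ∸ 1) * (r + edges q) over o ⊔ height q + scale j
  off′ j = ⊩-weaken (≤-reflexive (*-distribˡ-+ (j ∸ 1) r (edges q))) ≤-refl
    (⊩-⊕ (⊩-weaken ≤-refl (+-monoˡ-≤ (scale j) (m≤m⊔n o (height q))) (off j))
         (coarse g′ j (m≤n⊔m o (height q))))

good-⊕ : ∀ {p q} → Good p → Good q → Good (p ⊕ q)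
good-⊕ {p} {q} g g′ = record
  { regular = regular-⊕ (regular g) (regular g′)
  ; sparse  = λ h≤H → ⊩-⊕ (sparse g (m⊔n≤o⇒m≤o _ _ h≤H)) (sparse g′ (m⊔n≤o⇒n≤o (height p) _ h≤H))
  ; coarse  = λ j h≤H → ⊩-weaken (≤-reflexive (*-distribˡ-+ (j ∸ 1) (edges p) (edges q))) ≤-refl
      (⊩-⊕ (coarse g j (m⊔n≤o⇒m≤o _ _ h≤H)) (coarse g′ j (m⊔n≤o⇒n≤o (height p) _ h≤H)))
  ; spine   = spine′ (≤-total (height q) (height p)) }
  where
  spine′ : height q ≤ height p ⊎ height p ≤ height q → Spine (p ⊕ q)
  spine′ (inj₁ a) = spine-⊕ p q g g′ a
  spine′ (inj₂ a) = subst Spine (⊕-comm q p) (spine-⊕ q p g′ g a)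

-- The estimate at a central root

private variable
  P Q R : Profile

-- The maximum is attained off the path in `P`, off the path in `Q`, or by `R`. In the first two
-- cases that tree contributes `i ∸ 1` twice through its spine and the other long one `l ∸ 1`. In
-- the third, `P` contributes `l ∸ 1` and `Q`, `R` contribute `i ∸ 1` each.
tripod : Good P → Good Q → Good R → height R ≤ height Q → height Q ≤ height P →
         (spP : Spine P) (spQ : Spine Q) → ∀ i l →
         2 ^ i ≤ spP .proj₁ ⊔ (spQ .proj₁ ⊔ height R) → 2 ^ l ≤ height Q →
         P ⊕ Q ⊕ R ⊩ (l ∸ 1) + ((i ∸ 1) + (i ∸ 1)) over 1
tripod {P} {Q} {R} gP gQ gR hR≤hQ hQ≤hP
  (oP , _ , _ , _ , tripodP , _) (oQ , _ , _ , _ , tripodQ , _)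
  i l 2^i≤ 2^l≤hQ
  with m≤n⊔o⇒m≤n⊎m≤o oP _ 2^i≤
... | inj₁ 2^i≤oP = ⊩-weaken (≤-reflexive (lem (l ∸ 1) (i ∸ 1))) ≤-refl
      (⊩-⊕ (tripodP i 2^i≤oP) (⊩-⊕ (log-height (regular gQ) l 2^l≤hQ) ⊩-zero))
  where
  lem : ∀ a b → a + (b + b) ≡ b + b + (a + 0)
  lem = solve-∀
... | inj₂ 2^i≤′ with m≤n⊔o⇒m≤n⊎m≤o oQ _ 2^i≤′
...   | inj₁ 2^i≤oQ = ⊩-weaken (≤-reflexive (lem (l ∸ 1) (i ∸ 1))) ≤-refl
      (⊩-⊕ (log-height (regular gP) l (≤-trans 2^l≤hQ hQ≤hP)) (⊩-⊕ (tripodQ i 2^i≤oQ) ⊩-zero))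
  where
  lem : ∀ a b → a + (b + b) ≡ a + (b + b + 0)
  lem = solve-∀
...   | inj₂ 2^i≤hR = ⊩-⊕ (log-height (regular gP) l (≤-trans 2^l≤hQ hQ≤hP))
      (⊩-⊕ (log-height (regular gQ) i (≤-trans 2^i≤hR hR≤hQ)) (log-height (regular gR) i 2^i≤hR))

-- Turns an assumed upper bound `K` on the average into an upper bound on the structure counted by
-- `x`.
⊩-decrease : ∀ {p x K} → Regular p → ¬ (p ⊩ K over 1) → ∀ {y} → p ⊩ x over y → x ≤ y * K
⊩-decrease {p@(profile _ _ N M)} {x} {K} r ¬large {y} (average≥ a) =
  *-cancelʳ-≤ x (y * K) N {{>-nonZero (count≥1 r)}} (begin
    x * N        ≤⟨ a ⟩
    y * M        ≡⟨ cong (y *_) (*-identityˡ M) ⟨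
    y * (1 * M)  ≤⟨ *-monoʳ-≤ y (<⇒≤ (≰⇒> (λ b → ¬large (average≥ b)))) ⟩
    y * (K * N)  ≡⟨ *-assoc y K N ⟨
    y * K * N    ∎)
  where open ≤-Reasoning

⊩? : ∀ p x y → Dec (p ⊩ x over y)
⊩? p x y = map′ average≥ _⊩_over_.bound (x * count p ≤? y * missing p)

30j<2^j : ∀ j → 30 * (7 + j) + 1 ≤ 2 ^ (8 + j)
30j<2^j zero    = ≤ᵇ⇒≤ 211 256 _
30j<2^j (suc j) = certify 0
  (+-mono-≤ (30j<2^j j) (≤-trans (≤ᵇ⇒≤ 30 256 _) (^-monoʳ-≤ 2 (m≤m+n 8 j)))) (lem j (2 ^ (8 + j)))
  where
  lem : ∀ j A → 30 * (7 + suc j) + 1 + (A + A) + 0 ≡ 2 * A + (30 * (7 + j) + 1 + 30)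
  lem = solve-∀

-- With J = 8 + j, the hypotheses give r ≤ 15 (o + 2 (J − 1) 2^J) and r + 1 ≥ 2 · 4^J.
absorb-scale : ∀ j {k o r} → k ≤ 4 * (8 + j) + 3 → 2 ^ (2 * (8 + j) + 1) ≤ suc r →
               (7 + j) * r ≤ (o + scale (8 + j)) * (3 * k) → suc r ≤ 30 * o
absorb-scale j {k} {o} {r} k≤ 2ss≤ hyp = certify 0
  (+-mono-≤ (*-monoʳ-≤ 2 r≤) (+-mono-≤ 2ss≤
    (+-mono-≤ (*-monoʳ-≤ (2 * s) (30j<2^j j)) (*-monoʳ-≤ 2 (m^n>0 2 (8 + j))))))
  (lem₁ j o r s _ pow)
  where
  s b : ℕ
  s = 2 ^ (8 + j)
  b = 7 + j
  -- `3 * (4 * J + 3)` equals `12 * b + 21` with `b = J - 1`, and `b` is at least 7.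
  3k≤15b : 3 * k ≤ 15 * b
  3k≤15b = certify (3 * j) (*-monoʳ-≤ 3 k≤) (lem j (3 * k))
    where
    lem : ∀ j k → k + 3 * (4 * (8 + j) + 3) + 3 * j ≡ 15 * (7 + j) + k
    lem = solve-∀
  r≤ : r ≤ 15 * (o + 2 * (s * b))
  r≤ = *-cancelˡ-≤ b (≤-trans hyp (≤-trans (*-monoʳ-≤ (o + 2 * (s * b)) 3k≤15b)
         (≤-reflexive (lem (o + 2 * (s * b)) b))))
    where
    lem : ∀ x b → x * (15 * b) ≡ b * (15 * x)
    lem = solve-∀
  pow : 2 ^ (2 * (8 + j) + 1) ≡ 2 * (s * s)
  pow = begin
    2 ^ (2 * (8 + j) + 1)         ≡⟨ cong (2 ^_) (lem j) ⟩
    2 * 2 ^ ((8 + j) + (8 + j))   ≡⟨ cong (2 *_) (^-distribˡ-+-* 2 (8 + j) (8 + j)) ⟩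
    2 * (s * s)                   ∎
    where
    open ≡-Reasoning
    lem : ∀ j → 2 * (8 + j) + 1 ≡ suc ((8 + j) + (8 + j))
    lem = solve-∀
  lem₀ : ∀ j o r s →
    suc r + (2 * (15 * (o + 2 * (s * (7 + j)))) + (suc r + (2 * s * s + 2 * s))) + 0
    ≡ 30 * o + (2 * r + (2 * (s * s) + (2 * s * (30 * (7 + j) + 1) + 2 * 1)))
  lem₀ = solve-∀
  lem₁ : ∀ j o r s S → S ≡ 2 * (s * s) →
    suc r + (2 * (15 * (o + 2 * (s * (7 + j)))) + (suc r + (2 * s * s + 2 * s))) + 0
    ≡ 30 * o + (2 * r + (S + (2 * s * (30 * (7 + j) + 1) + 2 * 1)))
  lem₁ j o r s _ refl = lem₀ j o r s

quarter : ∀ k → ∃[ j ] (4 * j ≤ k × k ≤ 4 * j + 3)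
quarter 0 = 0 , z≤n , z≤n
quarter 1 = 0 , z≤n , s≤s z≤n
quarter 2 = 0 , z≤n , s≤s (s≤s z≤n)
quarter 3 = 0 , z≤n , ≤-refl
quarter (suc (suc (suc (suc k)))) with j , a , b ← quarter k =
  suc j , ≤-trans (≤-reflexive (*-suc 4 j)) (+-monoʳ-≤ 4 a)
        , ≤-trans (+-monoʳ-≤ 4 b) (≤-reflexive (cong (_+ 3) (≡.sym (*-suc 4 j))))

2^-cancel-≤ : ∀ {a b} → 2 ^ a ≤ 2 ^ b → a ≤ b
2^-cancel-≤ {a} {b} h with a ≤? b
... | yes p = p
... | no ¬p = contradiction h (<⇒≱ (^-monoʳ-< 2 (s≤s (s≤s z≤n)) (≰⇒> ¬p)))

module _ (gP : Good P) (gQ : Good Q) (gR : Good R)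
         (hR≤hQ : height R ≤ height Q) (hQ≤hP : height Q ≤ height P)
         (hP≤1+hQ : height P ≤ suc (height Q))
         where
  private
    T : Profile
    T = P ⊕ Q ⊕ R

    gT : Regular T
    gT = regular (good-⊕ gP (good-⊕ gQ gR))

  -- Few vertices off the longest path: the two halves of that path suffice.
  two-branches : ∀ {k x m} → x ≤ k → 2 ^ (2 + k) ≤ height P + height Q + m → m ≤ 2 ^ suc x →
                 T ⊩ (k ∸ 1) + (k ∸ 1) over 1
  two-branches {k} {x} {m} x≤ 2^k≤n m≤ =
    ⊩-⊕ (log-height (regular gP) k (≤-trans 2^k≤hQ hQ≤hP))
      (⊩-weaken (m≤m+n _ 0) ≤-refl (⊩-⊕ (log-height (regular gQ) k 2^k≤hQ) ⊩-zero))
    where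
    2^k≤hQ : 2 ^ k ≤ height Q
    2^k≤hQ = ≤-pred (*-cancelˡ-< 2 _ _ (certify 0
      (+-mono-≤ 2^k≤n (+-mono-≤ m≤ (+-mono-≤ hP≤1+hQ (^-monoʳ-≤ 2 (s≤s x≤)))))
      (lem (2 ^ k) (height P) (height Q) m (2 ^ suc x))))
      where
      lem : ∀ a p q m y →
        suc (2 * a) + (p + q + m + (y + (suc q + 2 * a))) + 0
        ≡ 2 * suc q + (2 * (2 * a) + (m + (p + y)))
      lem = solve-∀

  -- The five extra exponents absorb the factor 30: `32 * 2 ^ x ≤ m ≤ 30 * o` gives `2 ^ x ≤ o`. As
  -- `o` is at most the height of `P`, the whole tree has at most 31 times that height plus the
  -- height of `Q` vertices, which gives `2 ^ k ≤ height Q`.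
  three-branches : ∀ {k x o} (spP : Spine P) (spQ : Spine Q) →
                   o ≡ spP .proj₁ ⊔ (spQ .proj₁ ⊔ height R) →
                   ∀ {m} → 2 ^ (5 + k) ≤ height P + height Q + m → 2 ^ (5 + x) ≤ m → m ≤ 30 * o →
                   T ⊩ (k ∸ 1) + ((x ∸ 1) + (x ∸ 1)) over 1
  three-branches {k} {x} {o} spP@(oP , _ , oP≤ , _) spQ@(oQ , _ , oQ≤ , _) refl {m} 2^k≤ 2^x≤ m≤ =
    tripod gP gQ gR hR≤hQ hQ≤hP spP spQ x k 2^x≤o 2^k≤hQ
    where
    o≤hP : o ≤ height P
    o≤hP = ⊔-lub oP≤ (≤-trans (⊔-lub oQ≤ hR≤hQ) hQ≤hP)
    2^x≤o : 2 ^ x ≤ o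
    2^x≤o = *-cancelˡ-≤ 32 (≤-trans (≤-reflexive (≡.sym (^-distribˡ-+-* 2 5 x)))
      (≤-trans 2^x≤ (≤-trans m≤ (*-monoˡ-≤ o (≤ᵇ⇒≤ 30 32 _)))))
    2^k≤hQ : 2 ^ k ≤ height Q
    2^k≤hQ = ≤-pred (*-cancelˡ-< 32 _ _ (certify 0
      (+-mono-≤ 2^k≤ (+-mono-≤ m≤ (+-mono-≤ (*-monoʳ-≤ 30 o≤hP) (*-monoʳ-≤ 31 hP≤1+hQ))))
      (lem (2 ^ k) _ (height P) (height Q) m o (^-distribˡ-+-* 2 5 k))))
      where
      lem′ : ∀ a p q m o →
        suc (32 * a) + (p + q + m + (30 * o + (30 * p + 31 * suc q))) + 0
        ≡ 32 * suc q + (32 * a + (m + (30 * o + 31 * p)))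
      lem′ = solve-∀
      lem : ∀ a A p q m o → A ≡ 32 * a →
        suc (32 * a) + (p + q + m + (30 * o + (30 * p + 31 * suc q))) + 0
        ≡ 32 * suc q + (A + (m + (30 * o + 31 * p)))
      lem a _ p q m o refl = lem′ a p q m o

  -- The two spines and `coarse` for `R` bound the `r` edges off the path in terms of the average.
  -- As the average is below `3 * (5 + k)`, `absorb-scale` yields `m ≤ 30 * o`, with `m = suc r`
  -- because `m` also counts the root.
  many-off-path : ∀ j {k x m} → suc (edges T) ≡ height P + height Q + m →
                  2 ^ (5 + k) ≤ suc (edges T) → 2 ^ (5 + x) ≤ m →
                  5 + k ≤ 4 * (8 + j) + 3 → 2 * (8 + j) + 1 ≤ 5 + x → ¬ T ⊩ 3 * (5 + k) over 1 →
                  T ⊩ (k ∸ 1) + ((x ∸ 1) + (x ∸ 1)) over 1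
  many-off-path j {k} {x} {m} n≡ 2^k≤n 2^x≤m k≤ j≤ ¬large
    with spP@(oP , rP , _ , eqP , _ , offP) ← spine gP
       | spQ@(oQ , rQ , _ , eqQ , _ , offQ) ← spine gQ =
    three-branches {k} {x} {o} spP spQ refl (≤-trans 2^k≤n (≤-reflexive n≡)) 2^x≤m
      (≤-trans (≤-reflexive m≡) (absorb-scale j {5 + k} {o} {r} k≤
        (≤-trans (^-monoʳ-≤ 2 j≤) (≤-trans 2^x≤m (≤-reflexive m≡)))
        (⊩-decrease gT ¬large off-path)))
    where
    o r : ℕ
    o = oP ⊔ (oQ ⊔ height R)
    r = rP + (rQ + edges R)
    m≡ : m ≡ suc r
    m≡ = +-cancelˡ-≡ (height P + height Q) m (suc r) (trans (≡.sym n≡)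
      (trans (cong₂ (λ a b → suc (a + (b + edges R))) eqP eqQ)
             (lem (height P) (height Q) rP rQ (edges R))))
      where
      lem : ∀ p q a b c → suc (p + a + (q + b + c)) ≡ p + q + suc (a + (b + c))
      lem = solve-∀
    off-path : T ⊩ (7 + j) * r over o + scale (8 + j)
    off-path = ⊩-weaken (≤-reflexive (lem (7 + j) rP rQ (edges R))) ≤-refl
      (⊩-⊕ (⊩-weaken ≤-refl (+-monoˡ-≤ (scale (8 + j)) oP≤o) (offP (8 + j)))
      (⊩-⊕ (⊩-weaken ≤-refl (+-monoˡ-≤ (scale (8 + j)) oQ≤o) (offQ (8 + j)))
           (coarse gR (8 + j) hR≤o)))
      where
      oP≤o : oP ≤ o
      oP≤o = m≤m⊔n oP _
      oQ≤o : oQ ≤ o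
      oQ≤o = ≤-trans (m≤m⊔n oQ _) (m≤n⊔m oP _)
      hR≤o : height R ≤ o
      hR≤o = ≤-trans (m≤n⊔m oQ _) (m≤n⊔m oP _)
      lem : ∀ b x y z → b * (x + (y + z)) ≡ b * x + (b * y + b * z)
      lem = solve-∀

  x≤1+k : ∀ {k x m} → suc (edges T) ≡ height P + height Q + m → suc (edges T) ≤ 2 ^ suc k →
          2 ^ x ≤ m → x ≤ suc k
  x≤1+k {m = m} n≡ n≤ 2^x≤m = 2^-cancel-≤
    (≤-trans 2^x≤m (≤-trans (m≤n+m m _) (≤-trans (≤-reflexive (≡.sym n≡)) n≤)))

  central-bound : ∀ {k x m} → suc (edges T) ≡ height P + height Q + m →
                  2 ^ k ≤ suc (edges T) → suc (edges T) ≤ 2 ^ suc k → 2 ^ x ≤ m → m ≤ 2 ^ suc x →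
                  ∃[ a ] (T ⊩ a over 1 × k + (x + x) ≤ 100 + a)
  central-bound {k} {x} {m} n≡ 2^k≤n n≤ 2^x≤m m≤ with 33 ≤? k
  -- For small `k` the trivial average 0 suffices, as `k + (x + x)` is at most 32 + 66. For larger
  -- `k`, the quarter `j` is at least 8, as `absorb-scale` requires.
  ... | no k<33 = 0 , ⊩-zero , ≤-trans (+-mono-≤ k≤32 (+-mono-≤ x≤33 x≤33)) (≤ᵇ⇒≤ 98 100 _)
    where
    k≤32 : k ≤ 32
    k≤32 = ≤-pred (≰⇒> k<33)
    x≤33 : x ≤ 33
    x≤33 = ≤-trans (x≤1+k n≡ n≤ 2^x≤m) (s≤s k≤32)
  ... | yes 33≤k = main (quarter k)
    where
    n≡′ : 2 ^ k ≤ height P + height Q + m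
    n≡′ = ≤-trans 2^k≤n (≤-reflexive n≡)
    8≤j : ∀ j → k ≤ 4 * j + 3 → 8 ≤ j
    8≤j j k≤ = ≮⇒≥ λ j<8 → <⇒≱ 33≤k (≤-trans k≤
      (≤-trans (+-monoˡ-≤ 3 (*-monoʳ-≤ 4 (≤-pred j<8))) (n≤1+n 31)))
    at-most-100 : ∀ b {a} → b ≤ 100 → k + (x + x) ≤ b + a → k + (x + x) ≤ 100 + a
    at-most-100 b b≤ h = ≤-trans h (+-monoˡ-≤ _ b≤)
    main : ∃[ j ] (4 * j ≤ k × k ≤ 4 * j + 3) → ∃[ a ] (T ⊩ a over 1 × k + (x + x) ≤ 100 + a)
    main (j , 4j≤k , k≤4j+3) with x + x ≤? k | ⊩? T (3 * k) 1
    -- Since `x ≤ suc k`, the target exceeds `3 * k` by at most 2.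
    ... | no _ | yes large = 3 * k , large
        , at-most-100 2 (≤ᵇ⇒≤ 2 100 _) (certify 0 (+-mono-≤ x≤ x≤) (lem k x))
      where
      x≤ : x ≤ suc k
      x≤ = x≤1+k n≡ n≤ 2^x≤m
      lem : ∀ k x → k + (x + x) + (suc k + suc k) + 0 ≡ 2 + 3 * k + (x + x)
      lem = solve-∀
    -- Here `m * m` is at most four times the number of vertices.
    ... | yes 2x≤k | _ with k′ , refl ← m≤n⇒∃[o]m+o≡n (≤-trans (m≤m+n 3 30) 33≤k) =
        _ , two-branches x≤ n≡′ m≤ , at-most-100 6 (≤ᵇ⇒≤ 6 100 _) (certify 0 2x≤k (lem k′ x))
      where
      lem : ∀ k x → 3 + k + (x + x) + (3 + k) + 0 ≡ 6 + (k + k) + (x + x)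
      lem = solve-∀
      x≤ : x ≤ suc k′
      x≤ = ≮⇒≥ λ k<x → <⇒≱ (certify k′ (+-mono-≤ k<x k<x) (lem′ k′ x)) 2x≤k
        where
        lem′ : ∀ k x → suc (3 + k) + (x + x) + k ≡ x + x + (suc (suc k) + suc (suc k))
        lem′ = solve-∀
    ... | no k<2x | no ¬large
        with j′ , refl ← m≤n⇒∃[o]m+o≡n (8≤j j k≤4j+3)
           | k′ , refl ← m≤n⇒∃[o]m+o≡n (≤-trans (m≤m+n 5 28) 33≤k) =
        deep (m≤n⇒∃[o]m+o≡n (≤-trans
          (m≤n⇒m≤n+o 1 (≤-trans (m≤m+n 5 11) (*-monoʳ-≤ 2 (m≤m+n 8 j′)))) 2j<x))
      where
      -- Makes `m` at least `2 * 4 ^ J` for `J = 8 + j′`, the threshold of `absorb-scale`.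
      2j<x : 2 * (8 + j′) + 1 ≤ x
      2j<x = ≮⇒≥ λ x<2j → k<2x (≤-trans (certify 0 (+-mono-≤ x<2j x<2j) (lem (8 + j′) x)) 4j≤k)
        where
        lem : ∀ j x → x + x + (2 * j + 1 + (2 * j + 1)) + 0 ≡ 4 * j + (suc x + suc x)
        lem = solve-∀
      deep : ∃[ x′ ] 5 + x′ ≡ x → ∃[ a ] (T ⊩ a over 1 × 5 + k′ + (x + x) ≤ 100 + a)
      deep (x′ , refl) =
        _ , many-off-path j′ {k′} {x′} n≡ 2^k≤n 2^x≤m k≤4j+3 2j<x ¬large
        , at-most-100 18 (≤ᵇ⇒≤ 18 100 _)
            (certify 0 (+-mono-≤ (m≤n+m∸n k′ 1) (+-mono-≤ (m≤n+m∸n x′ 1) (m≤n+m∸n x′ 1)))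
              (lem k′ x′ (k′ ∸ 1) (x′ ∸ 1)))
        where
        lem : ∀ k x a b → 5 + k + (5 + x + (5 + x)) + (1 + a + (1 + b + (1 + b))) + 0
                        ≡ 18 + (a + (b + b)) + (k + (x + x))
        lem = solve-∀

-- Rooted trees and their subtrees

-- c ▹ t hangs c below the root of t.
data Tree (n : ℕ) : Set where
  leaf : Fin n → Tree n
  _▹_  : Tree n → Tree n → Tree n

infixr 5 _▹_

private variable
  n : ℕ

profileOf : Tree n → Profile
profileOf (leaf _) = single-vertex
profileOf (c ▹ t)  = plant (profileOf c) ⊕ profileOf t

good : (t : Tree n) → Good (profileOf t)
good (leaf _) = good-single
good (c ▹ t)  = good-⊕ (good-plant (good c)) (good t)

-- A subtree of `c ▹ t` that avoids the root lies wholly in `t` or wholly in `c`, and then misses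
-- all vertices of the other part.
rooted# missing# rootless# rootlessMissing# size : Tree n → ℕ
rooted#  t = count (profileOf t)
missing# t = missing (profileOf t)
size     t = suc (edges (profileOf t))

rootless# (leaf _) = 0
rootless# (c ▹ t)  = rootless# t + (rooted# c + rootless# c)

rootlessMissing# (leaf _) = 0
rootlessMissing# (c ▹ t)  =
  rootlessMissing# t + rootless# t * size c
    + (missing# c + rootlessMissing# c + (rooted# c + rootless# c) * size t)

-- Jamison: the mean order of the subtrees through a given vertex is at least the global mean.
root-average≤rootless-average : (t : Tree n) → missing# t * rootless# t ≤ rootlessMissing# t * rooted# t
root-average≤rootless-average (leaf _) = z≤n
-- `L * U ≤ X * K` is the induction for `t`, and `M * V ≤ Y * N` is the one for `c`, extended to all
-- its subtrees. In the mixed terms, the missing vertices on one side are bounded by the number of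
-- edges there.
root-average≤rootless-average (c ▹ t) = certify (Y * K + V * K)
  (+-mono-≤ (*-monoʳ-≤ (suc N) (root-average≤rootless-average t))
  (+-mono-≤ (*-monoʳ-≤ (K * U) M⁺≤)
  (+-mono-≤ (*-monoʳ-≤ (V * suc N) (missing≤edges*count (regular (good t))))
  (+-mono-≤ (*-monoʳ-≤ K MV≤YN)
            (*-monoʳ-≤ (K * V) (edges<count (regular (good c))))))))
  (lem N M K L U V X Y (edges (profileOf c)) (edges (profileOf t)))
  where
  N M K L U V X Y : ℕ
  N = rooted# c
  M = missing# c
  K = rooted# t
  L = missing# t
  U = rootless# t
  V = rooted# c + rootless# c
  X = rootlessMissing# t
  Y = missing# c + rootlessMissing# c
  M⁺≤ : M + size c ≤ size c * suc N
  M⁺≤ = missing≤edges*count (regular (good-plant (good c)))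
  MV≤YN : M * V ≤ Y * N
  MV≤YN = certify 0 (root-average≤rootless-average c) (lem N M (rootless# c) (rootlessMissing# c))
    where
    lem : ∀ N M U X → M * (N + U) + X * N + 0 ≡ (M + X) * N + M * U
    lem = solve-∀
  lem : ∀ N M K L U V X Y e f →
    (K * (M + suc e) + suc N * L) * (U + V)
      + (suc N * (X * K) + (K * U * (suc e * suc N)
        + (V * suc N * (f * K) + (K * (Y * N) + K * V * N))))
      + (Y * K + V * K)
    ≡ (X + U * suc e + (Y + V * suc f)) * (suc N * K)
      + (suc N * (L * U) + (K * U * (M + suc e) + (V * suc N * L + (K * (M * V) + K * V * suc e))))
  lem = solve-∀

-- By Jamison's inequality the lower bound `a` passes to the subtrees avoiding the root, after
-- multiplying by `N` and cancelling it.
average-all : ∀ {a} (t : Tree n) → profileOf t ⊩ a over 1 →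
              a * (rooted# t + rootless# t) ≤ missing# t + rootlessMissing# t
average-all {a = a} t (average≥ aN≤M) = begin
  a * (N + U)    ≡⟨ *-distribˡ-+ a N U ⟩
  a * N + a * U  ≤⟨ +-mono-≤ aN≤M′ (*-cancelʳ-≤ (a * U) X N (begin
      a * U * N    ≡⟨ lem a U N ⟩
      a * N * U    ≤⟨ *-monoˡ-≤ U aN≤M′ ⟩
      M * U        ≤⟨ root-average≤rootless-average t ⟩
      X * N        ∎)) ⟩
  M + X          ∎
  where
  open ≤-Reasoning
  N M U X : ℕ
  N = rooted# t
  M = missing# t
  U = rootless# t
  X = rootlessMissing# t
  instance _ = >-nonZero (count≥1 (regular (good t)))
  aN≤M′ : a * N ≤ M
  aN≤M′ = ≤-trans aN≤M (≤-reflexive (*-identityˡ M))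
  lem : ∀ a U N → a * U * N ≡ a * N * U
  lem = solve-∀

-- The list of subtrees and its total order

rooted rootless subtrees : Tree n → List (Subset n)
rooted (leaf v) = ⁅ v ⁆ ∷ []
-- `⊥` stands for the choice of not entering `c`.
rooted (c ▹ t)  = cartesianProductWith _∪_ (⊥ ∷ rooted c) (rooted t)

rootless (leaf _) = []
rootless (c ▹ t)  = rootless t ++ (rooted c ++ rootless c)

subtrees t = rooted t ++ rootless t

∣p∪q∣≤∣p∣+∣q∣ : (p q : Subset n) → ∣ p ∪ q ∣ ≤ ∣ p ∣ + ∣ q ∣
∣p∪q∣≤∣p∣+∣q∣ []            []            = z≤n
∣p∪q∣≤∣p∣+∣q∣ (outside ∷ p) (outside ∷ q) = ∣p∪q∣≤∣p∣+∣q∣ p q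
∣p∪q∣≤∣p∣+∣q∣ (outside ∷ p) (inside ∷ q)  =
  ≤-trans (s≤s (∣p∪q∣≤∣p∣+∣q∣ p q)) (≤-reflexive (≡.sym (+-suc ∣ p ∣ ∣ q ∣)))
∣p∪q∣≤∣p∣+∣q∣ (inside ∷ p)  (outside ∷ q) = s≤s (∣p∪q∣≤∣p∣+∣q∣ p q)
∣p∪q∣≤∣p∣+∣q∣ (inside ∷ p)  (inside ∷ q)  =
  s≤s (≤-trans (∣p∪q∣≤∣p∣+∣q∣ p q) (+-monoʳ-≤ ∣ p ∣ (n≤1+n ∣ q ∣)))

totalOrder-++ : (xs ys : List (Subset n)) → totalOrder (xs ++ ys) ≡ totalOrder xs + totalOrder ys
totalOrder-++ xs ys = trans (cong sum (map-++ ∣_∣ xs ys)) (sum-++ (map ∣_∣ xs) (map ∣_∣ ys))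

totalOrder-map-∪ : (p : Subset n) (ys : List (Subset n)) →
                   totalOrder (map (p ∪_) ys) ≤ length ys * ∣ p ∣ + totalOrder ys
totalOrder-map-∪ p []       = z≤n
totalOrder-map-∪ p (y ∷ ys) = certify 0 (+-mono-≤ (∣p∪q∣≤∣p∣+∣q∣ p y) (totalOrder-map-∪ p ys))
  (lem (∣ p ∪ y ∣) (totalOrder (map (p ∪_) ys)) ∣ p ∣ ∣ y ∣ (length ys) (totalOrder ys))
  where
  lem : ∀ u s p y l t → u + s + (p + y + (l * p + t)) + 0 ≡ p + l * p + (y + t) + (u + s)
  lem = solve-∀

totalOrder-product : (xs ys : List (Subset n)) →
  totalOrder (cartesianProductWith _∪_ xs ys)
    ≤ length ys * totalOrder xs + length xs * totalOrder ys
totalOrder-product []       ys = z≤n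
totalOrder-product (x ∷ xs) ys = begin
  totalOrder (map (x ∪_) ys ++ cartesianProductWith _∪_ xs ys)
    ≡⟨ totalOrder-++ (map (x ∪_) ys) _ ⟩
  totalOrder (map (x ∪_) ys) + totalOrder (cartesianProductWith _∪_ xs ys)
    ≤⟨ +-mono-≤ (totalOrder-map-∪ x ys) (totalOrder-product xs ys) ⟩
  length ys * ∣ x ∣ + totalOrder ys + (length ys * totalOrder xs + length xs * totalOrder ys)
    ≡⟨ lem (length ys) ∣ x ∣ (totalOrder ys) (totalOrder xs) (length xs) ⟩
  length ys * (∣ x ∣ + totalOrder xs) + (totalOrder ys + length xs * totalOrder ys)  ∎
  where
  open ≤-Reasoning
  lem : ∀ l x t s m → l * x + t + (l * s + m * t) ≡ l * (x + s) + (t + m * t)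
  lem = solve-∀

length-product : ∀ {A B C : Set} (f : A → B → C) xs ys →
                 length (cartesianProductWith f xs ys) ≡ length xs * length ys
length-product f []       ys = refl
length-product f (x ∷ xs) ys = trans (length-++ (map (f x) ys))
  (cong₂ _+_ (length-map (f x) ys) (length-product f xs ys))

length-rooted : (t : Tree n) → length (rooted t) ≡ rooted# t
length-rooted (leaf _) = refl
length-rooted (c ▹ t)  = trans (length-product _∪_ (⊥ ∷ rooted c) (rooted t))
  (cong₂ _*_ (cong suc (length-rooted c)) (length-rooted t))

length-rootless : (t : Tree n) → length (rootless t) ≡ rootless# t
length-rootless (leaf _) = refl
length-rootless (c ▹ t)  = trans (length-++ (rootless t)) (cong₂ _+_ (length-rootless t)
  (trans (length-++ (rooted c)) (cong₂ _+_ (length-rooted c) (length-rootless c))))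

length-subtrees : (t : Tree n) → length (subtrees t) ≡ rooted# t + rootless# t
length-subtrees t = trans (length-++ (rooted t)) (cong₂ _+_ (length-rooted t) (length-rootless t))

totalOrder-rooted : (t : Tree n) → totalOrder (rooted t) + missing# t ≤ size t * rooted# t
totalOrder-rooted (leaf v) = ≤-reflexive (cong (λ z → z + 0 + 0) (∣⁅x⁆∣≡1 v))
totalOrder-rooted {n} (c ▹ t) = certify 0
  (+-mono-≤ product≤ (+-mono-≤ (*-monoʳ-≤ (rooted# t) (totalOrder-rooted c))
                               (*-monoʳ-≤ (suc (rooted# c)) (totalOrder-rooted t))))
  (lem (totalOrder (rooted (c ▹ t))) (totalOrder (rooted c)) (totalOrder (rooted t))
       (rooted# c) (missing# c) (rooted# t) (missing# t)
       (edges (profileOf c)) (edges (profileOf t)))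
  where
  product≤ : totalOrder (rooted (c ▹ t))
           ≤ rooted# t * totalOrder (rooted c) + suc (rooted# c) * totalOrder (rooted t)
  product≤ = subst₂
    (λ k m → totalOrder (rooted (c ▹ t)) ≤ k * totalOrder (rooted c) + suc m * totalOrder (rooted t))
    (length-rooted t) (length-rooted c)
    (subst (λ z → totalOrder (rooted (c ▹ t)) ≤ length (rooted t) * (z + totalOrder (rooted c))
                    + suc (length (rooted c)) * totalOrder (rooted t))
       (∣⊥∣≡0 n) (totalOrder-product (⊥ ∷ rooted c) (rooted t)))
  lem : ∀ T C D N M K L e f →
    T + (K * (M + suc e) + suc N * L)
      + (K * C + suc N * D + (K * (suc e * N) + suc N * (suc f * K))) + 0
    ≡ suc (suc e + f) * (suc N * K) + (T + (K * (C + M) + suc N * (D + L)))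
  lem = solve-∀

totalOrder-rootless : (t : Tree n) → totalOrder (rootless t) + rootlessMissing# t ≤ size t * rootless# t
totalOrder-rootless (leaf _) = z≤n
totalOrder-rootless (c ▹ t)
  rewrite totalOrder-++ (rootless t) (rooted c ++ rootless c) | totalOrder-++ (rooted c) (rootless c) =
  certify 0 (+-mono-≤ (totalOrder-rootless t) (+-mono-≤ (totalOrder-rooted c) (totalOrder-rootless c)))
    (lem (totalOrder (rootless t)) (totalOrder (rooted c)) (totalOrder (rootless c)) (rootlessMissing# t)
         (rootless# t) (missing# c) (rootlessMissing# c) (rooted# c) (rootless# c)
         (edges (profileOf c)) (edges (profileOf t)))
  where
  lem : ∀ o r q X U M Y N V e f →
    o + (r + q) + (X + U * suc e + (M + Y + (N + V) * suc f))
      + (suc f * U + (suc e * N + suc e * V)) + 0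
    ≡ suc (suc e + f) * (U + (N + V)) + (o + X + (r + M + (q + Y)))
  lem = solve-∀

totalOrder-subtrees : ∀ {a} (t : Tree n) → profileOf t ⊩ a over 1 →
  totalOrder (subtrees t) + a * length (subtrees t) ≤ size t * length (subtrees t)
totalOrder-subtrees {a = a} t avg rewrite length-subtrees t | totalOrder-++ (rooted t) (rootless t) =
  certify 0 (+-mono-≤ (average-all t avg) (+-mono-≤ (totalOrder-rooted t) (totalOrder-rootless t)))
    (lem (totalOrder (rooted t)) (totalOrder (rootless t)) (a * (rooted# t + rootless# t))
         (missing# t) (rootlessMissing# t) (size t) (rooted# t) (rootless# t))
  where
  lem : ∀ r o w M X s N U →
    r + o + w + (M + X + (s * N + s * U)) + 0 ≡ s * (N + U) + (w + (r + M + (o + X)))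
  lem = solve-∀

-- Vertex sets and distinctness of the listed subtrees

root : Tree n → Fin n
root (leaf v) = v
root (c ▹ t)  = root t

vertices : Tree n → Subset n
vertices (leaf v) = ⁅ v ⁆
vertices (c ▹ t)  = vertices c ∪ vertices t

Disjoint : Subset n → Subset n → Set
Disjoint p q = ∀ {x} → x ∈ₛ p → x ∉ₛ q

∈-∪ˡ : ∀ {p q : Subset n} {x} → x ∈ₛ p → x ∈ₛ p ∪ q
∈-∪ˡ x∈p = x∈p∪q⁺ (inj₁ x∈p)

∈-∪ʳ : ∀ {p q : Subset n} {x} → x ∈ₛ q → x ∈ₛ p ∪ q
∈-∪ʳ x∈q = x∈p∪q⁺ (inj₂ x∈q)

∪-lub : ∀ {p q r : Subset n} → p ⊆ r → q ⊆ r → p ∪ q ⊆ r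
∪-lub {p = p} {q} p⊆r q⊆r x∈ = [ p⊆r , q⊆r ]′ (x∈p∪q⁻ p q x∈)

∪-mono : ∀ {p q p′ q′ : Subset n} → p ⊆ p′ → q ⊆ q′ → p ∪ q ⊆ p′ ∪ q′
∪-mono p⊆ q⊆ = ∪-lub (∈-∪ˡ ∘ p⊆) (∈-∪ʳ ∘ q⊆)

⊆⇒∩≡ : ∀ {p q : Subset n} → p ⊆ q → p ∩ q ≡ p
⊆⇒∩≡ {p = p} {q} p⊆q = ⊆-antisym (p∩q⊆p p q) (λ x∈p → x∈p∩q⁺ (x∈p , p⊆q x∈p))

disjoint-∣∪∣ : (p q : Subset n) → Disjoint p q → ∣ p ∪ q ∣ ≡ ∣ p ∣ + ∣ q ∣
disjoint-∣∪∣ []            []            d = refl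
disjoint-∣∪∣ (outside ∷ p) (outside ∷ q) d = disjoint-∣∪∣ p q (λ a b → d (there a) (there b))
disjoint-∣∪∣ (outside ∷ p) (inside ∷ q)  d =
  trans (cong suc (disjoint-∣∪∣ p q (λ a b → d (there a) (there b)))) (≡.sym (+-suc ∣ p ∣ ∣ q ∣))
disjoint-∣∪∣ (inside ∷ p)  (outside ∷ q) d =
  cong suc (disjoint-∣∪∣ p q (λ a b → d (there a) (there b)))
disjoint-∣∪∣ (inside ∷ p)  (inside ∷ q)  d = contradiction here (d here)

data Separated {n} : Tree n → Set where
  leaf : ∀ v → Separated (leaf v)
  node : ∀ {c t} → Separated c → Separated t → Disjoint (vertices c) (vertices t) →
         Separated (c ▹ t)

size≡∣vertices∣ : ∀ {t : Tree n} → Separated t → size t ≡ ∣ vertices t ∣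
size≡∣vertices∣ (leaf v) = ≡.sym (∣⁅x⁆∣≡1 v)
size≡∣vertices∣ (node {c} {t} sc st d) = begin
  size (c ▹ t)                             ≡⟨ +-suc (size c) _ ⟨
  size c + size t                          ≡⟨ cong₂ _+_ (size≡∣vertices∣ sc) (size≡∣vertices∣ st) ⟩
  ∣ vertices c ∣ + ∣ vertices t ∣          ≡⟨ disjoint-∣∪∣ (vertices c) (vertices t) d ⟨
  ∣ vertices (c ▹ t) ∣                     ∎
  where open ≡-Reasoning

root∈vertices : (t : Tree n) → root t ∈ₛ vertices t
root∈vertices (leaf v) = x∈⁅x⁆ v
root∈vertices (c ▹ t)  = ∈-∪ʳ (root∈vertices t)

rooted-⊆ : ∀ (t : Tree n) {S} → S ∈ rooted t → S ⊆ vertices t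
rooted-⊆ (leaf v) (here refl) = id
rooted-⊆ (c ▹ t) S∈ with ∈-cartesianProductWith⁻ _∪_ (⊥ ∷ rooted c) (rooted t) S∈
... | _ , _ , here refl , b∈ , refl = ∪-mono (λ x∈⊥ → contradiction x∈⊥ ∉⊥) (rooted-⊆ t b∈)
... | _ , _ , there a∈  , b∈ , refl = ∪-mono (rooted-⊆ c a∈) (rooted-⊆ t b∈)

rooted-root : ∀ (t : Tree n) {S} → S ∈ rooted t → root t ∈ₛ S
rooted-root (leaf v) (here refl) = x∈⁅x⁆ v
rooted-root (c ▹ t) S∈ with ∈-cartesianProductWith⁻ _∪_ (⊥ ∷ rooted c) (rooted t) S∈
... | _ , _ , _ , b∈ , refl = ∈-∪ʳ (rooted-root t b∈)

rootless-split : ∀ (c t : Tree n) {S} → S ∈ rootless (c ▹ t) → S ∈ rootless t ⊎ S ∈ subtrees c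
rootless-split c t = ∈-++⁻ (rootless t)

subtrees-⊆ : ∀ (t : Tree n) {S} → S ∈ subtrees t → S ⊆ vertices t
rootless-⊆   : ∀ (t : Tree n) {S} → S ∈ rootless t → S ⊆ vertices t
subtrees-⊆ t S∈ with ∈-++⁻ (rooted t) S∈
... | inj₁ a = rooted-⊆ t a
... | inj₂ a = rootless-⊆ t a
rootless-⊆ (c ▹ t) S∈ with rootless-split c t S∈
... | inj₁ a = ∈-∪ʳ ∘ rootless-⊆ t a
... | inj₂ a = ∈-∪ˡ ∘ subtrees-⊆ c a

subtrees-nonempty : ∀ (t : Tree n) {S} → S ∈ subtrees t → Nonempty S
rootless-nonempty   : ∀ (t : Tree n) {S} → S ∈ rootless t → Nonempty S
subtrees-nonempty t S∈ with ∈-++⁻ (rooted t) S∈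
... | inj₁ a = root t , rooted-root t a
... | inj₂ a = rootless-nonempty t a
rootless-nonempty (c ▹ t) S∈ with rootless-split c t S∈
... | inj₁ a = rootless-nonempty t a
... | inj₂ a = subtrees-nonempty c a

rootless-∌root : ∀ {t : Tree n} → Separated t → ∀ {S} → S ∈ rootless t → root t ∉ₛ S
rootless-∌root (node {c} {t} sc st d) S∈ r∈ with rootless-split c t S∈
... | inj₁ a = rootless-∌root st a r∈
... | inj₂ a = d (subtrees-⊆ c a r∈) (root∈vertices t)

unique-map : ∀ {A B : Set} (f : A → B) {xs} → (∀ {a b} → a ∈ xs → b ∈ xs → f a ≡ f b → a ≡ b) →
             Unique xs → Unique (map f xs)
unique-map f inj []       = []
unique-map f inj (x∉ ∷ u) =
  All.map⁺ (All.tabulate λ b∈ eq → All.lookup x∉ b∈ (inj (here refl) (there b∈) eq))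
  ∷ unique-map f (λ a∈ b∈ → inj (there a∈) (there b∈)) u

unique-product : ∀ {A B C : Set} (f : A → B → C) {xs ys} →
  (∀ {a a′ b b′} → a ∈ xs → a′ ∈ xs → b ∈ ys → b′ ∈ ys → f a b ≡ f a′ b′ → a ≡ a′ × b ≡ b′) →
  Unique xs → Unique ys → Unique (cartesianProductWith f xs ys)
unique-product f inj [] uy = []
unique-product f {x ∷ xs} {ys} inj (x∉ ∷ ux) uy = Unique.++⁺
  (unique-map (f x) (λ b∈ b′∈ eq → inj (here refl) (here refl) b∈ b′∈ eq .proj₂) uy)
  (unique-product f (λ a∈ a′∈ → inj (there a∈) (there a′∈)) ux uy)
  λ (z∈₁ , z∈₂) → case ∈-map⁻ (f x) z∈₁ of λ where
    (b , b∈ , refl) → case ∈-cartesianProductWith⁻ f xs ys z∈₂ of λ where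
      (a′ , b′ , a′∈ , b′∈ , eq) →
        All.lookup x∉ a′∈ (inj (here refl) (there a′∈) b∈ b′∈ eq .proj₁)

∪-injectiveˡ : ∀ {A B p p′ q q′ : Subset n} → Disjoint A B → p ⊆ A → p′ ⊆ A → q ⊆ B → q′ ⊆ B →
               p ∪ q ≡ p′ ∪ q′ → p ≡ p′
∪-injectiveˡ {n} {A} {B} d p⊆ p′⊆ q⊆ q′⊆ eq = ⊆-antisym (half p⊆ q′⊆ eq) (half p′⊆ q⊆ (≡.sym eq))
  where
  half : ∀ {p p′ q q′ : Subset n} → p ⊆ A → q′ ⊆ B → p ∪ q ≡ p′ ∪ q′ → p ⊆ p′
  half {p′ = p′} {q′ = q′} p⊆ q′⊆ eq {x} x∈p with x∈p∪q⁻ p′ q′ (subst (x ∈ₛ_) eq (∈-∪ˡ x∈p))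
  ... | inj₁ x∈p′ = x∈p′
  ... | inj₂ x∈q′ = contradiction (q′⊆ x∈q′) (d (p⊆ x∈p))

∪-injective : ∀ {A B p p′ q q′ : Subset n} → Disjoint A B → p ⊆ A → p′ ⊆ A → q ⊆ B → q′ ⊆ B →
              p ∪ q ≡ p′ ∪ q′ → p ≡ p′ × q ≡ q′
∪-injective {p = p} {p′} {q} {q′} d p⊆ p′⊆ q⊆ q′⊆ eq =
  ∪-injectiveˡ d p⊆ p′⊆ q⊆ q′⊆ eq
  , ∪-injectiveˡ (λ b a → d a b) q⊆ q′⊆ p⊆ p′⊆ (trans (∪-comm q p) (trans eq (∪-comm p′ q′)))

rooted-unique : ∀ {t : Tree n} → Separated t → Unique (rooted t)
rooted-unique (leaf v) = [] ∷ []
rooted-unique (node {c} {t} sc st d) = unique-product _∪_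
  (λ a∈ a′∈ b∈ b′∈ → ∪-injective d (⊆c a∈) (⊆c a′∈) (rooted-⊆ t b∈) (rooted-⊆ t b′∈))
  (All.tabulate (λ { S∈ refl → ∉⊥ (rooted-root c S∈) }) ∷ rooted-unique sc) (rooted-unique st)
  where
  ⊆c : ∀ {S} → S ∈ ⊥ ∷ rooted c → S ⊆ vertices c
  ⊆c (here refl) x∈ = contradiction x∈ ∉⊥
  ⊆c (there S∈)  = rooted-⊆ c S∈

-- The root separates the rooted subtrees from the others. Those from `c` and from `t` differ
-- because they are nonempty subsets of disjoint vertex sets.
subtrees-unique : ∀ {t : Tree n} → Separated t → Unique (subtrees t)
rootless-unique   : ∀ {t : Tree n} → Separated t → Unique (rootless t)
subtrees-unique {t = t} s = Unique.++⁺ (rooted-unique s) (rootless-unique s)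
  λ (a , b) → rootless-∌root s b (rooted-root t a)
rootless-unique (leaf v) = []
rootless-unique (node {c} {t} sc st d) = Unique.++⁺ (rootless-unique st) (subtrees-unique sc)
  λ (a , b) → case rootless-nonempty t a of λ where
    (x , x∈) → d (subtrees-⊆ c b x∈) (rootless-⊆ t a x∈)

⁅root⁆⊆ : ∀ (t : Tree n) → ⁅ root t ⁆ ⊆ vertices t
⁅root⁆⊆ t x∈ = subst (_∈ₛ vertices t) (≡.sym (x∈⁅y⁆⇒x≡y _ x∈)) (root∈vertices t)

∪-swap : (p q r : Subset n) → p ∪ (q ∪ r) ≡ q ∪ (p ∪ r)
∪-swap p q r = trans (≡.sym (∪-assoc p q r)) (trans (cong (_∪ r) (∪-comm p q)) (∪-assoc q p r))

-- Spanning trees of a graph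

module Spanning {n : ℕ} (G : Graph n) where

  _~_ : Fin n → Fin n → Set
  _~_ = Adj G

  -- By the last argument of `node`, the edge between the two roots is the only edge of `G` between
  -- the two parts, so an embedded tree is the subgraph induced on its vertices.
  data Embedded : Tree n → Set where
    leaf : ∀ v → Embedded (leaf v)
    node : ∀ {c t} → Embedded c → Embedded t → Disjoint (vertices c) (vertices t) →
           root c ~ root t →
           (∀ {u w} → u ∈ₛ vertices c → w ∈ₛ vertices t → u ~ w → u ≡ root c × w ≡ root t) →
           Embedded (c ▹ t)

  separated : ∀ {t} → Embedded t → Separated t
  separated (leaf v)           = leaf v
  separated (node ec et d _ _) = node (separated ec) (separated et) d

  -- The invariant for passing from the whole tree to a branch: a connected set may extend beyond
  -- the branch, but only through its root.
  RootExits : Tree n → Set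
  RootExits t = ∀ {u w} → u ∈ₛ vertices t → w ∉ₛ vertices t → u ~ w → u ≡ root t

  rootExits-child : ∀ {c t} → Embedded (c ▹ t) → RootExits (c ▹ t) → RootExits c
  rootExits-child {c} {t} (node _ _ d _ link) exits {u} {w} u∈c w∉c u~w with w ∈? vertices t
  ... | yes w∈t = link u∈c w∈t u~w .proj₁
  ... | no  w∉t = contradiction (root∈vertices t)
        (subst (_∉ₛ vertices t) (exits (∈-∪ˡ u∈c) ([ w∉c , w∉t ]′ ∘ x∈p∪q⁻ _ _) u~w) (d u∈c))

  rootExits-rest : ∀ {c t} → Embedded (c ▹ t) → RootExits (c ▹ t) → RootExits t
  rootExits-rest {c} {t} (node _ _ d _ link) exits {u} {w} u∈t w∉t u~w with w ∈? vertices c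
  ... | yes w∈c = link w∈c u∈t (sym G u~w) .proj₂
  ... | no  w∉c = exits (∈-∪ʳ u∈t) ([ w∉c , w∉t ]′ ∘ x∈p∪q⁻ _ _) u~w

  -- Connected sets and completeness of the list

  Reach : Subset n → Fin n → Fin n → Set
  Reach S u v = ∃[ vs ] (Walk G u v vs × All (_∈ₛ S) vs)

  ConnectedIn : Subset n → Set
  ConnectedIn S = ∀ u v → u ∈ₛ S → v ∈ₛ S → Reach S u v

  reach-refl : ∀ {S u} → u ∈ₛ S → Reach S u u
  reach-refl {u = u} u∈ = u ∷ [] , single u , u∈ ∷ []

  reach-trans : ∀ {S u v w} → Reach S u v → Reach S v w → Reach S u w
  reach-trans (_ , single _ , _) r = r
  reach-trans (_ , step a p , u∈ ∷ ps) r with vs , q , qs ← reach-trans (_ , p , ps) r =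
    _ , step a q , u∈ ∷ qs

  reach-step : ∀ {S u v} → u ∈ₛ S → v ∈ₛ S → u ~ v → Reach S u v
  reach-step u∈ v∈ a = _ , step a (single _) , u∈ ∷ v∈ ∷ []

  reach-source : ∀ {S u v} → Reach S u v → u ∈ₛ S
  reach-source (_ , single _ , u∈ ∷ _) = u∈
  reach-source (_ , step _ _ , u∈ ∷ _) = u∈

  reach-sym : ∀ {S u v} → Reach S u v → Reach S v u
  reach-sym (_ , single u , u∈ ∷ _) = reach-refl u∈
  reach-sym (_ , step a p , u∈ ∷ ps) =
    reach-trans (reach-sym (_ , p , ps)) (reach-step (reach-source (_ , p , ps)) u∈ (sym G a))

  reach-mono : ∀ {S S′ u v} → S ⊆ S′ → Reach S u v → Reach S′ u v
  reach-mono S⊆ (vs , p , ps) = vs , p , All.map S⊆ ps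

  rooted-reach : ∀ {t} → Embedded t → ∀ {S} → S ∈ rooted t → ∀ {u} → u ∈ₛ S → Reach S u (root t)
  rooted-reach (leaf v) (here refl) u∈ with refl ← x∈⁅y⁆⇒x≡y v u∈ = reach-refl u∈
  rooted-reach (node {c} {t} ec et d c~t _) S∈ u∈
    with ∈-cartesianProductWith⁻ _∪_ (⊥ ∷ rooted c) (rooted t) S∈
  ... | A , B , A∈ , B∈ , refl with x∈p∪q⁻ A B u∈
  ...   | inj₂ u∈B = reach-mono ∈-∪ʳ (rooted-reach et B∈ u∈B)
  ...   | inj₁ u∈A with A∈
  ...     | here refl = contradiction u∈A ∉⊥
  ...     | there A∈c = reach-trans (reach-mono ∈-∪ˡ (rooted-reach ec A∈c u∈A))
              (reach-step (∈-∪ˡ (rooted-root c A∈c)) (∈-∪ʳ (rooted-root t B∈)) c~t)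

  subtrees-connected : ∀ {t} → Embedded t → ∀ {S} → S ∈ subtrees t → ConnectedIn S
  rootless-connected   : ∀ {t} → Embedded t → ∀ {S} → S ∈ rootless t → ConnectedIn S
  subtrees-connected {t} e S∈ with ∈-++⁻ (rooted t) S∈
  ... | inj₁ a = λ u v u∈ v∈ → reach-trans (rooted-reach e a u∈) (reach-sym (rooted-reach e a v∈))
  ... | inj₂ a = rootless-connected e a
  rootless-connected (node {c} {t} ec et _ _ _) S∈ with rootless-split c t S∈
  ... | inj₁ a = rootless-connected et a
  ... | inj₂ a = subtrees-connected ec a

  crossing : ∀ {S A u v vs} → Walk G u v vs → All (_∈ₛ S) vs → u ∈ₛ A → v ∉ₛ A →
             ∃[ a ] ∃[ b ] (a ∈ₛ A × b ∉ₛ A × a ∈ₛ S × a ~ b)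
  crossing (single _) _ u∈A v∉A = contradiction u∈A v∉A
  crossing {A = A} {u} (step {v = w} u~w p) (u∈S ∷ ps) u∈A v∉A with w ∈? A
  ... | no  w∉A = u , w , u∈A , w∉A , u∈S , u~w
  ... | yes w∈A = crossing p ps w∈A v∉A

  root-on-exit : ∀ t {S x y} → RootExits t → ConnectedIn S →
                 x ∈ₛ S → x ∈ₛ vertices t → y ∈ₛ S → y ∉ₛ vertices t → root t ∈ₛ S
  root-on-exit t {S} exits conn x∈S x∈t y∈S y∉t
    with _ , walk , walk⊆S ← conn _ _ x∈S y∈S
    with a , b , a∈t , b∉t , a∈S , a~b ← crossing walk walk⊆S x∈t y∉t =
    subst (_∈ₛ S) (exits a∈t b∉t a~b) a∈S

  -- Intersecting with `vertices t` lets the induction keep the same connected `S`, which in general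
  -- extends beyond each part.
  rooted-complete : ∀ {t S} → Embedded t → RootExits t → ConnectedIn S → root t ∈ₛ S →
                    S ∩ vertices t ∈ rooted t
  rooted-complete {leaf v} {S} _ _ _ v∈S = here (⊆-antisym (p∩q⊆q S ⁅ v ⁆)
    λ x∈ → x∈p∩q⁺ (subst (_∈ₛ S) (≡.sym (x∈⁅y⁆⇒x≡y v x∈)) v∈S , x∈))
  rooted-complete {c ▹ t} {S} e@(node ec et d _ _) exits conn r∈S =
    subst (_∈ rooted (c ▹ t)) (≡.sym (∩-distribˡ-∪ S (vertices c) (vertices t)))
      (∈-cartesianProductWith⁺ _∪_ child (rooted-complete et (rootExits-rest e exits) conn r∈S))
    where
    child : S ∩ vertices c ∈ ⊥ ∷ rooted c
    child with root c ∈? S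
    ... | yes rc∈S = there (rooted-complete ec (rootExits-child e exits) conn rc∈S)
    -- `S` contains the root of `t`, so if it met `c` it would leave `c` through the root of `c`.
    ... | no  rc∉S = here (Empty-unique λ (x , x∈) → let x∈S , x∈c = x∈p∩q⁻ S (vertices c) x∈ in
            rc∉S (root-on-exit c (rootExits-child e exits) conn x∈S x∈c r∈S
                    (λ r∈c → d r∈c (root∈vertices t))))

  rooted-complete-⊆ : ∀ {t S} → Embedded t → RootExits t → ConnectedIn S → S ⊆ vertices t →
                      root t ∈ₛ S → S ∈ rooted t
  rooted-complete-⊆ {t} e exits conn S⊆ r∈S =
    subst (_∈ rooted t) (⊆⇒∩≡ S⊆) (rooted-complete e exits conn r∈S)

  subtrees-complete : ∀ {t S} → Embedded t → RootExits t → ConnectedIn S → S ⊆ vertices t →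
                      Nonempty S → S ∈ subtrees t
  -- If `S` met both `c` and `t`, it would leave `t` through its root. Hence it lies wholly in one
  -- of them.
  rootless-complete   : ∀ {t S} → Embedded t → RootExits t → ConnectedIn S → S ⊆ vertices t →
                      Nonempty S → root t ∉ₛ S → S ∈ rootless t
  subtrees-complete {t} {S} e exits conn S⊆ ne with root t ∈? S
  ... | yes r∈S = ∈-++⁺ˡ (rooted-complete-⊆ e exits conn S⊆ r∈S)
  ... | no  r∉S = ∈-++⁺ʳ (rooted t) (rootless-complete e exits conn S⊆ ne r∉S)
  rootless-complete {leaf v} {S} _ _ _ S⊆ (x , x∈S) r∉S =
    contradiction (subst (_∈ₛ S) (x∈⁅y⁆⇒x≡y v (S⊆ x∈S)) x∈S) r∉S
  rootless-complete {c ▹ t} {S} e@(node ec et d _ _) exits conn S⊆ ne@(x , x∈S) r∉S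
    with x∈p∪q⁻ (vertices c) (vertices t) (S⊆ x∈S)
  ... | inj₂ x∈t = ∈-++⁺ˡ (rootless-complete et (rootExits-rest e exits) conn S⊆t ne r∉S)
    where
    S⊆t : S ⊆ vertices t
    S⊆t {y} y∈S with y ∈? vertices t
    ... | yes y∈t = y∈t
    ... | no  y∉t = contradiction (root-on-exit t (rootExits-rest e exits) conn x∈S x∈t y∈S y∉t) r∉S
  ... | inj₁ x∈c = ∈-++⁺ʳ (rootless t) (subtrees-complete ec (rootExits-child e exits) conn S⊆c ne)
    where
    S⊆c : S ⊆ vertices c
    S⊆c {y} y∈S with x∈p∪q⁻ (vertices c) (vertices t) (S⊆ y∈S)
    ... | inj₁ y∈c = y∈c
    ... | inj₂ y∈t = contradiction
          (root-on-exit t (rootExits-rest e exits) conn y∈S y∈t x∈S (d x∈c)) r∉S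

  subtrees-correct : ∀ {t} → Embedded t → (∀ x → x ∈ₛ vertices t) →
                     ∀ S → S ∈ subtrees t ⇔ IsSubtree G S
  subtrees-correct {t} e all S = mk⇔
    (λ S∈ → subtrees-nonempty t S∈ , subtrees-connected e S∈)
    (λ (ne , conn) → subtrees-complete e (λ _ w∉ → contradiction (all _) w∉) conn (λ _ → all _) ne)

  -- Paths in embedded trees

  PathIn : Subset n → Fin n → Fin n → List (Fin n) → Set
  PathIn S u v vs = Path G u v vs × All (_∈ₛ S) vs

  walk-++ : ∀ {u v w x vs ws} → Walk G u v vs → v ~ w → Walk G w x ws → Walk G u x (vs ++ ws)
  walk-++ (single _) a q = step a q
  walk-++ (step b p) a q = step b (walk-++ p a q)

  path-++ : ∀ {A B u v w x vs ws} → Disjoint A B → PathIn A u v vs → v ~ w → PathIn B w x ws →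
            PathIn (A ∪ B) u x (vs ++ ws)
  path-++ d ((p , up) , p⊆) a ((q , uq) , q⊆) =
    (walk-++ p a q , Unique.++⁺ up uq (λ (x , y) → d (All.lookup p⊆ x) (All.lookup q⊆ y)))
    , All.++⁺ (All.map ∈-∪ˡ p⊆) (All.map ∈-∪ʳ q⊆)

  path-mono : ∀ {A B u v vs} → A ⊆ B → PathIn A u v vs → PathIn B u v vs
  path-mono A⊆ (p , p⊆) = p , All.map A⊆ p⊆

  path-single : ∀ v → PathIn ⁅ v ⁆ v v (v ∷ [])
  path-single v = (single v , [] ∷ []) , x∈⁅x⁆ v ∷ []

  path-exists : ∀ {t} → Embedded t → ∀ {u v} → u ∈ₛ vertices t → v ∈ₛ vertices t →
                ∃[ vs ] PathIn (vertices t) u v vs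
  path-exists (leaf x) u∈ v∈ with refl ← x∈⁅y⁆⇒x≡y x u∈ | refl ← x∈⁅y⁆⇒x≡y x v∈ = _ , path-single x
  path-exists (node {c} {t} ec et d c~t _) u∈ v∈
    with x∈p∪q⁻ (vertices c) (vertices t) u∈ | x∈p∪q⁻ (vertices c) (vertices t) v∈
  ... | inj₁ u∈c | inj₁ v∈c = _ , path-mono ∈-∪ˡ (path-exists ec u∈c v∈c .proj₂)
  ... | inj₂ u∈t | inj₂ v∈t = _ , path-mono ∈-∪ʳ (path-exists et u∈t v∈t .proj₂)
  ... | inj₁ u∈c | inj₂ v∈t = _ , path-++ d (path-exists ec u∈c (root∈vertices c) .proj₂) c~t
                                            (path-exists et (root∈vertices t) v∈t .proj₂)
  ... | inj₂ u∈t | inj₁ v∈c = _ , path-mono (∪-lub ∈-∪ʳ ∈-∪ˡ)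
        (path-++ (λ a b → d b a) (path-exists et u∈t (root∈vertices t) .proj₂) (sym G c~t)
                                 (path-exists ec (root∈vertices c) v∈c .proj₂))

  depth : Tree n → ℕ
  depth t = height (profileOf t)

  -- Follows the taller side at each gluing. `ascend` is the same path reversed, so that `long-path`
  -- can join an upward to a downward path.
  descend : ∀ {t} → Embedded t →
            ∃[ v ] ∃[ vs ] (PathIn (vertices t) (root t) v vs × length vs ≡ suc (depth t))
  descend (leaf v) = v , _ , path-single v , refl
  descend (node {c} {t} ec et d c~t _) with ≤-total (depth t) (suc (depth c))
  ... | inj₁ t≤c with v , vs , p , len ← descend ec =
        v , _ , path-mono (∪-lub (∈-∪ʳ ∘ ⁅root⁆⊆ t) ∈-∪ˡ)
          (path-++ (λ x∈ x∈c → d x∈c (⁅root⁆⊆ t x∈))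
             (path-single (root t)) (sym G c~t) p)
        , cong suc (trans len (≡.sym (m≥n⇒m⊔n≡m t≤c)))
  ... | inj₂ c≤t with v , vs , p , len ← descend et =
        v , vs , path-mono ∈-∪ʳ p , trans len (cong suc (≡.sym (m≤n⇒m⊔n≡n c≤t)))

  ascend : ∀ {t} → Embedded t →
           ∃[ v ] ∃[ vs ] (PathIn (vertices t) v (root t) vs × length vs ≡ suc (depth t))
  ascend (leaf v) = v , _ , path-single v , refl
  ascend (node {c} {t} ec et d c~t _) with ≤-total (depth t) (suc (depth c))
  ... | inj₁ t≤c with v , vs , p , len ← ascend ec =
        v , _ , path-mono (∪-lub ∈-∪ˡ (∈-∪ʳ ∘ ⁅root⁆⊆ t))
          (path-++ (λ x∈c x∈ → d x∈c (⁅root⁆⊆ t x∈))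
             p c~t (path-single (root t)))
        , trans (length-++ vs) (trans (+-comm (length vs) 1)
            (cong suc (trans len (≡.sym (m≥n⇒m⊔n≡m t≤c)))))
  ... | inj₂ c≤t with v , vs , p , len ← ascend et =
        v , vs , path-mono ∈-∪ʳ p , trans len (cong suc (≡.sym (m≤n⇒m⊔n≡n c≤t)))

  -- Growing a spanning tree

  -- `w` is hung as a leaf below `u`. That `u` is its only neighbour in the tree keeps the enlarged
  -- tree induced.
  insert : ∀ {t u w} → Embedded t → u ∈ₛ vertices t → w ∉ₛ vertices t → w ~ u →
           (∀ {x} → x ∈ₛ vertices t → w ~ x → x ≡ u) →
           ∃[ t′ ] (Embedded t′ × root t′ ≡ root t × vertices t′ ≡ ⁅ w ⁆ ∪ vertices t)
  insert {w = w} (leaf v) u∈ w∉ w~u only with refl ← x∈⁅y⁆⇒x≡y v u∈ =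
    leaf w ▹ leaf v
    , node (leaf w) (leaf v) (λ x∈w x∈v → w∉ (subst (_∈ₛ ⁅ v ⁆) (x∈⁅y⁆⇒x≡y w x∈w) x∈v)) w~u
        (λ x∈ y∈ _ → x∈⁅y⁆⇒x≡y w x∈ , x∈⁅y⁆⇒x≡y v y∈)
    , refl , refl
  insert {u = u} {w} (node {c} {t} ec et d c~t link) u∈ w∉ w~u only
    with x∈p∪q⁻ (vertices c) (vertices t) u∈
  ... | inj₁ u∈c with c′ , ec′ , r≡ , v≡ ← insert ec u∈c (w∉ ∘ ∈-∪ˡ) w~u (only ∘ ∈-∪ˡ) =
    c′ ▹ t
    , node ec′ et (λ x∈ → d′ (subst (_ ∈ₛ_) v≡ x∈)) (subst (_~ root t) (≡.sym r≡) c~t)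
        (λ x∈ y∈ x~y → link′ (subst (_ ∈ₛ_) v≡ x∈) y∈ x~y)
    , refl , trans (cong (_∪ vertices t) v≡) (∪-assoc ⁅ w ⁆ (vertices c) (vertices t))
    where
    d′ : Disjoint (⁅ w ⁆ ∪ vertices c) (vertices t)
    d′ x∈ x∈t with x∈p∪q⁻ ⁅ w ⁆ (vertices c) x∈
    ... | inj₁ x∈w = w∉ (∈-∪ʳ (subst (_∈ₛ vertices t) (x∈⁅y⁆⇒x≡y w x∈w) x∈t))
    ... | inj₂ x∈c = d x∈c x∈t
    link′ : ∀ {x y} → x ∈ₛ ⁅ w ⁆ ∪ vertices c → y ∈ₛ vertices t → x ~ y → x ≡ root c′ × y ≡ root t
    link′ x∈ y∈t x~y with x∈p∪q⁻ ⁅ w ⁆ (vertices c) x∈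
    ... | inj₂ x∈c = trans (link x∈c y∈t x~y .proj₁) (≡.sym r≡) , link x∈c y∈t x~y .proj₂
    ... | inj₁ x∈w with refl ← x∈⁅y⁆⇒x≡y w x∈w =
      contradiction y∈t (subst (_∉ₛ vertices t) (≡.sym (only (∈-∪ʳ y∈t) x~y)) (d u∈c))
  ... | inj₂ u∈t with t′ , et′ , r≡ , v≡ ← insert et u∈t (w∉ ∘ ∈-∪ʳ) w~u (only ∘ ∈-∪ʳ) =
    c ▹ t′
    , node ec et′ (λ x∈c x∈ → d′ x∈c (subst (_ ∈ₛ_) v≡ x∈)) (subst (root c ~_) (≡.sym r≡) c~t)
        (λ x∈ y∈ x~y → link′ x∈ (subst (_ ∈ₛ_) v≡ y∈) x~y)
    , r≡ , trans (cong (vertices c ∪_) v≡) (∪-swap (vertices c) ⁅ w ⁆ (vertices t))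
    where
    d′ : Disjoint (vertices c) (⁅ w ⁆ ∪ vertices t)
    d′ x∈c x∈ with x∈p∪q⁻ ⁅ w ⁆ (vertices t) x∈
    ... | inj₁ x∈w = w∉ (∈-∪ˡ (subst (_∈ₛ vertices c) (x∈⁅y⁆⇒x≡y w x∈w) x∈c))
    ... | inj₂ x∈t = d x∈c x∈t
    link′ : ∀ {x y} → x ∈ₛ vertices c → y ∈ₛ ⁅ w ⁆ ∪ vertices t → x ~ y → x ≡ root c × y ≡ root t′
    link′ x∈c y∈ x~y with x∈p∪q⁻ ⁅ w ⁆ (vertices t) y∈
    ... | inj₂ y∈t = link x∈c y∈t x~y .proj₁ , trans (link x∈c y∈t x~y .proj₂) (≡.sym r≡)
    ... | inj₁ y∈w with refl ← x∈⁅y⁆⇒x≡y w y∈w =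
      contradiction u∈t (d (subst (_∈ₛ vertices c) (only (∈-∪ˡ x∈c) (sym G x~y)) x∈c))

  path-length≥2 : ∀ {S u v vs} → PathIn S u v vs → u ≢ v → 2 ≤ length vs
  path-length≥2 ((single _ , _) , _) u≢v = contradiction refl u≢v
  path-length≥2 ((step _ (single _) , _) , _) u≢v = s≤s (s≤s z≤n)
  path-length≥2 ((step _ (step _ _) , _) , _) u≢v = s≤s (s≤s z≤n)

  -- A second neighbour `x` of `w` would close a cycle with the tree path from `x` to `u`.
  unique-neighbour : ¬ HasCycle G → ∀ {t u w x} → Embedded t → w ∉ₛ vertices t →
                     u ∈ₛ vertices t → w ~ u → x ∈ₛ vertices t → w ~ x → x ≡ u
  unique-neighbour acyclic {t} {u} {w} {x} e w∉ u∈ w~u x∈ w~x with x ≟ᶠ u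
  ... | yes x≡u = x≡u
  ... | no  x≢u with vs , p@((walk , unique) , vs⊆) ← path-exists e x∈ u∈ = contradiction
    (w , u , w ∷ vs , (step w~x walk , All.map (λ { y∈ refl → w∉ y∈ }) vs⊆ ∷ unique)
       , s≤s (path-length≥2 p x≢u) , sym G w~u)
    acyclic

  module _ (tree : IsTree G) where

    -- `k` bounds the number of vertices still to be added. A walk from the root to a missing vertex
    -- leaves the tree along some edge, whose outer end is inserted.
    spanning : ∀ k {t} → Embedded t → n ≤ ∣ vertices t ∣ + k →
               ∃[ t′ ] (Embedded t′ × vertices t′ ≡ ⊤)
    spanning zero {t} e n≤ = t , e
      , ∣p∣≡n⇒p≡⊤ (≤-antisym (∣p∣≤n (vertices t)) (≤-trans n≤ (≤-reflexive (+-identityʳ _))))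
    spanning (suc k) {t} e n≤ with any? (λ x → ¬? (x ∈? vertices t))
    ... | no none = t , e , ⊆-antisym (λ _ → ∈⊤)
          (λ {x} _ → decidable-stable (x ∈? vertices t) (λ x∉ → none (x , x∉)))
    ... | yes (x , x∉)
      with _ , walk ← tree .proj₁ (root t) x
      with u , w , u∈ , w∉ , _ , u~w
           ← crossing {S = ⊤} walk (All.tabulate (λ _ → ∈⊤)) (root∈vertices t) x∉
      with t′ , e′ , _ , v≡ ← insert e u∈ w∉ (sym G u~w)
                                (unique-neighbour (tree .proj₂) e w∉ u∈ (sym G u~w)) =
      spanning k e′ (≤-trans n≤ (≤-reflexive (begin
        ∣ vertices t ∣ + suc k          ≡⟨ +-suc _ k ⟩
        suc ∣ vertices t ∣ + k          ≡⟨ cong (λ z → z + ∣ vertices t ∣ + k) (∣⁅x⁆∣≡1 w) ⟨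
        ∣ ⁅ w ⁆ ∣ + ∣ vertices t ∣ + k  ≡⟨ cong (_+ k) (disjoint-∣∪∣ ⁅ w ⁆ (vertices t) new) ⟨
        ∣ ⁅ w ⁆ ∪ vertices t ∣ + k      ≡⟨ cong (λ z → ∣ z ∣ + k) v≡ ⟨
        ∣ vertices t′ ∣ + k             ∎)))
      where
      open ≡-Reasoning
      new : Disjoint ⁅ w ⁆ (vertices t)
      new y∈w y∈t = w∉ (subst (_∈ₛ vertices t) (x∈⁅y⁆⇒x≡y w y∈w) y∈t)

  -- Moving the root to the centre

  commute : ∀ {c c′ t} → Embedded (c ▹ c′ ▹ t) → Embedded (c′ ▹ c ▹ t)
  commute {c} {c′} {t} (node ec (node ec′ et d′ c′~t link′) d c~t link) =
    node ec′ (node ec et (λ x y → d x (∈-∪ʳ y)) c~t (λ x y → link x (∈-∪ʳ y)))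
      (λ x∈c′ x∈ → [ (λ x∈c → d x∈c (∈-∪ˡ x∈c′)) , d′ x∈c′ ]′ (x∈p∪q⁻ (vertices c) (vertices t) x∈))
      c′~t link″
    where
    link″ : ∀ {u w} → u ∈ₛ vertices c′ → w ∈ₛ vertices (c ▹ t) → u ~ w → u ≡ root c′ × w ≡ root t
    link″ u∈ w∈ u~w with x∈p∪q⁻ (vertices c) (vertices t) w∈
    ... | inj₂ w∈t = link′ u∈ w∈t u~w
    ... | inj₁ w∈c = contradiction (root∈vertices t)
          (d′ (subst (_∈ₛ vertices c′) (link w∈c (∈-∪ˡ u∈) (sym G u~w) .proj₂) u∈))

  reroot : ∀ {c t} → Embedded (c ▹ t) → Embedded (t ▹ c)
  reroot (node ec et d c~t link) = node et ec (λ a b → d b a) (sym G c~t)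
    (λ u∈ w∈ u~w → let a , b = link w∈ u∈ (sym G u~w) in b , a)

  replace-rest : ∀ {c t t′} → Embedded (c ▹ t) → Embedded t′ →
                 root t′ ≡ root t → vertices t′ ≡ vertices t → Embedded (c ▹ t′)
  replace-rest {c} (node ec et d c~t link) et′ r≡ v≡ =
    node ec et′ (λ {x} a b → d a (subst (x ∈ₛ_) v≡ b)) (subst (root c ~_) (≡.sym r≡) c~t)
      (λ {u} {w} u∈ w∈ u~w → 
        let a , b = link u∈ (subst (w ∈ₛ_) v≡ w∈) u~w in a , trans b (≡.sym r≡))

  -- One pass of a selection sort: bring the tallest branch of the rest to the front, then swap it
  -- with `c` if it is taller.
  tallest-first : ∀ c t → Embedded (c ▹ t) →
    ∃[ c′ ] ∃[ t′ ] (Embedded (c′ ▹ t′) × root t′ ≡ root t × vertices (c′ ▹ t′) ≡ vertices (c ▹ t)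
      × depth t′ ≤ suc (depth c′) × depth (c′ ▹ t′) ≡ depth (c ▹ t))
  tallest-first c (leaf v) e = c , leaf v , e , refl , refl , z≤n , refl
  tallest-first c (c₁ ▹ t₁) e@(node _ et _ _ _)
    with c₂ , t₂ , e₂ , r≡ , v≡ , ≤₂ , h≡ ← tallest-first c₁ t₁ et
    with ≤-total (depth (c₂ ▹ t₂)) (suc (depth c))
  ... | inj₁ le = c , c₂ ▹ t₂ , replace-rest e e₂ r≡ v≡ , r≡ , cong (vertices c ∪_) v≡ , le
                , cong (suc (depth c) ⊔_) h≡
  ... | inj₂ ge = c₂ , c ▹ t₂ , commute (replace-rest e e₂ r≡ v≡) , r≡
                , trans (∪-swap (vertices c₂) (vertices c) (vertices t₂)) (cong (vertices c ∪_) v≡)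
                , ⊔-lub (≤-trans ge (≤-reflexive (m≥n⇒m⊔n≡m ≤₂))) ≤₂
                , trans (x⊔y⊔z (suc (depth c₂)) (suc (depth c)) (depth t₂))
                    (cong (suc (depth c) ⊔_) h≡)
    where
    x⊔y⊔z : ∀ x y z → x ⊔ (y ⊔ z) ≡ y ⊔ (x ⊔ z)
    x⊔y⊔z x y z = trans (≡.sym (⊔-assoc x y z)) (trans (cong (_⊔ z) (⊔-comm x y)) (⊔-assoc y x z))

  -- Such a root is a midpoint of a longest path. It has at least two branches, hence the
  -- alternative of at most two vertices in `centre`.
  Central : Subset n → Set
  Central V = ∃[ c ] ∃[ c′ ] ∃[ t ] (Embedded (c ▹ c′ ▹ t) × vertices (c ▹ c′ ▹ t) ≡ V
    × depth t ≤ suc (depth c′) × depth c′ ≤ depth c × depth c ≤ suc (depth c′))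

  -- Moving the root into the tallest branch while that branch is taller than the rest.
  centre : ∀ k t → Embedded t → depth t ≤ k → Central (vertices t) ⊎ ∣ vertices t ∣ ≤ 2
  centre k (leaf v) e _ = inj₂ (≤-trans (≤-reflexive (∣⁅x⁆∣≡1 v)) (s≤s z≤n))
  centre k (c ▹ t) e h≤k with tallest-first c t e
  ... | c₁ , t₁ , e₁ , _ , v≡ , t≤c , h≡ rewrite ≡.sym v≡ | ≡.sym h≡ = go k t₁ e₁ t≤c h≤k
    where
    go : ∀ k t₁ → Embedded (c₁ ▹ t₁) → depth t₁ ≤ suc (depth c₁) → suc (depth c₁) ⊔ depth t₁ ≤ k →
         Central (vertices (c₁ ▹ t₁)) ⊎ ∣ vertices (c₁ ▹ t₁) ∣ ≤ 2
    go k t₁ e₁ t≤c h≤k with depth c₁ ≤? depth t₁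
    go zero t₁ e₁ t≤c h≤k | no _ = contradiction (m⊔n≤o⇒m≤o (suc (depth c₁)) (depth t₁) h≤k) λ ()
    go (suc k) t₁ e₁ t≤c h≤k | no c≰t =
      -- The depth drops by one: `c₁` loses the edge above it, and `t₁`, being less deep than `c₁`,
      -- gains one.
      subst (λ V → Central V ⊎ ∣ V ∣ ≤ 2) (∪-comm (vertices t₁) (vertices c₁))
        (centre k (t₁ ▹ c₁) (reroot e₁)
          (⊔-lub (≤-trans (≰⇒> c≰t) c≤k) c≤k))
      where
      c≤k : depth c₁ ≤ k
      c≤k = ≤-pred (m⊔n≤o⇒m≤o (suc (depth c₁)) (depth t₁) h≤k)
    go k (c₂ ▹ t₂) e₁@(node _ e₂ _ _ _) t≤c h≤k | yes c≤t
      with c₃ , t₃ , e₃ , r≡ , v≡ , ≤₃ , h≡ ← tallest-first c₂ t₂ e₂ =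
      inj₁ (c₁ , c₃ , t₃ , replace-rest e₁ e₃ r≡ v≡ , cong (vertices c₁ ∪_) v≡ , ≤₃
           , ≤-pred (≤-trans (m≤m⊔n (suc (depth c₃)) (depth t₃)) (≤-trans (≤-reflexive h≡) t≤c))
           , ≤-trans c≤t (≤-reflexive (trans (≡.sym h≡) (m≥n⇒m⊔n≡m ≤₃))))
    -- There is no second branch, and `c₁` has depth 0, so the tree is a single edge.
    go k (leaf v) e₁ t≤c h≤k | yes c≤0 =
      inj₂ (subst (_≤ 2) (size≡∣vertices∣ (separated e₁)) (flat c₁ c≤0))
      where
      flat : ∀ c → depth c ≤ 0 → size (c ▹ leaf v) ≤ 2
      flat (leaf _) _ = ≤-refl
      flat (c ▹ t) h≤0 = contradiction (m⊔n≤o⇒m≤o (suc (depth c)) (depth t) h≤0) λ ()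

  long-path : ∀ {c c′ t} → Embedded (c ▹ c′ ▹ t) → ∀ {d} → IsDiameter G d →
              suc (depth c) + suc (depth c′) ≤ d
  long-path {c} {c′} {t} (node ec (node ec′ et d′ c′~t _) d c~t _) (_ , longest)
    with u , us , pu , lu ← ascend ec | v , vs , pv , lv ← descend ec′
    with walk , _ ← path-++ (λ x y → d x (∪-lub (∈-∪ʳ ∘ ⁅root⁆⊆ t) ∈-∪ˡ y)) pu c~t
                      (path-++ (λ x y → d′ y (⁅root⁆⊆ t x))
                        (path-single (root t)) (sym G c′~t) pv) =
    ≤-trans (≤-reflexive (cong (_∸ 1) (begin
      suc (suc (depth c) + suc (depth c′))  ≡⟨ +-suc (suc (depth c)) (suc (depth c′)) ⟨
      suc (depth c) + suc (suc (depth c′))  ≡⟨ cong₂ (λ a b → a + suc b) lu lv ⟨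
      length us + suc (length vs)           ≡⟨ length-++ us ⟨
      length (us ++ root t ∷ vs)            ∎))) (longest u v _ walk)
    where open ≡-Reasoning

  totalOrder≤ : (L : List (Subset n)) → totalOrder L ≤ n * length L
  totalOrder≤ []      = z≤n
  totalOrder≤ (S ∷ L) =
    ≤-trans (+-mono-≤ (∣p∣≤n S) (totalOrder≤ L)) (≤-reflexive (≡.sym (*-suc n (length L))))

-- From the local average to the theorem

log₂ : ∀ m → ∃[ k ] (2 ^ k ≤ suc m × suc m ≤ 2 ^ suc k)
log₂ zero = 0 , ≤-refl , s≤s z≤n
log₂ (suc m) with k , lo , hi ← log₂ m with 2 + m ≤? 2 ^ suc k
... | yes p = k , ≤-trans lo (n≤1+n _) , p
... | no ¬p = suc k , <⇒≤ (≰⇒> ¬p) , ≤-trans (s≤s hi) (≤-trans (≤-reflexive (+-comm 1 _))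
        (+-monoʳ-≤ (2 ^ suc k) (≤-trans (m^n>0 2 (suc k)) (≤-reflexive (≡.sym (+-identityʳ _))))))

-- Eliminates the approximate logarithm `a` of `m`: raise `m ≤ 2 ^ (a + C)` to the power `w` and add
-- exponents.
exponentiate : ∀ {n m w a t} C → t + a * w ≤ n * w → m ≤ 2 ^ (a + C) →
               2 ^ t * m ^ w ≤ 2 ^ ((n + C) * w)
exponentiate {n} {m} {w} {a} {t} C t≤ m≤ = begin
  2 ^ t * m ^ w                ≤⟨ *-monoʳ-≤ (2 ^ t) (^-monoˡ-≤ w m≤) ⟩
  2 ^ t * (2 ^ (a + C)) ^ w    ≡⟨ cong (2 ^ t *_) (^-*-assoc 2 (a + C) w) ⟩
  2 ^ t * 2 ^ ((a + C) * w)    ≡⟨ ^-distribˡ-+-* 2 t ((a + C) * w) ⟨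
  2 ^ (t + (a + C) * w)        ≤⟨ ^-monoʳ-≤ 2 (certify {y = (n + C) * w} 0 t≤ (lem t a C n w)) ⟩
  2 ^ ((n + C) * w)            ∎
  where
  open ≤-Reasoning
  lem : ∀ t a C n w → t + (a + C) * w + n * w + 0 ≡ (n + C) * w + (t + a * w)
  lem = solve-∀

module _ {n : ℕ} (G : Graph n) (1≤n : 1 ≤ n) (tree : IsTree G) {d : ℕ} (diam : IsDiameter G d)
         {L : List (Subset n)} (unique : Unique L) (correct : ∀ S → (S ∈ L) ⇔ IsSubtree G S) where
  open Spanning G

  -- a is log₂ n + 2 log₂ (n − d) up to an additive constant.
  mean-bound : ∃[ a ] (totalOrder L + a * length L ≤ n * length L × n * (n ∸ d) ^ 2 ≤ 2 ^ (a + 103))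
  mean-bound with t , e , t≡⊤ ← spanning tree n (leaf (fromℕ< 1≤n)) (m≤n+m n _)
             with centre (depth t) t e ≤-refl
  -- With at most two vertices, `a = 0` works, as the product is at most `2 ^ 3`.
  ... | inj₂ ∣t∣≤2 = 0 , ≤-trans (≤-reflexive (+-identityʳ _)) (totalOrder≤ L)
      , ≤-trans (*-mono-≤ n≤2 (^-monoˡ-≤ 2 (≤-trans (m∸n≤m n d) n≤2))) (^-monoʳ-≤ 2 (≤ᵇ⇒≤ 3 103 _))
    where
    n≤2 : n ≤ 2
    n≤2 = subst (_≤ 2) (trans (cong ∣_∣ t≡⊤) (∣⊤∣≡n n)) ∣t∣≤2
  ... | inj₁ (c , c′ , t′ , e′ , T≡t , t′≤ , c′≤c , c≤) = a , total , power
    where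
    T : Tree n
    T = c ▹ c′ ▹ t′
    E δ k x : ℕ
    E = edges (profileOf T)
    δ = suc (depth c) + suc (depth c′)
    T≡⊤ : vertices T ≡ ⊤
    T≡⊤ = trans T≡t t≡⊤
    size≡n : suc E ≡ n
    size≡n = trans (size≡∣vertices∣ (separated e′)) (trans (cong ∣_∣ T≡⊤) (∣⊤∣≡n n))
    -- `log₂` brackets the successor of its argument: `suc E` is the number of vertices, and
    -- `suc (E ∸ δ)` counts the root and the vertices off the path.
    k = log₂ E .proj₁
    x = log₂ (E ∸ δ) .proj₁

    δ≤E : δ ≤ E
    δ≤E = ≤-trans (+-mono-≤ (s≤s (height≤edges (regular (good c))))
                            (s≤s (height≤edges (regular (good c′)))))
                  (+-monoʳ-≤ (suc (edges (profileOf c))) (m≤m+n _ _))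

    central : ∃[ a ] (profileOf T ⊩ a over 1 × k + (x + x) ≤ 100 + a)
    central = central-bound (good-plant (good c)) (good-plant (good c′)) (good t′)
      t′≤ (s≤s c′≤c) (s≤s c≤) {k} {x}
      (≡.sym (trans (+-suc δ (E ∸ δ)) (cong suc (m+[n∸m]≡n δ≤E))))
      (log₂ E .proj₂ .proj₁) (log₂ E .proj₂ .proj₂)
      (log₂ (E ∸ δ) .proj₂ .proj₁) (log₂ (E ∸ δ) .proj₂ .proj₂)

    a : ℕ
    a = central .proj₁

    everywhere : ∀ y → y ∈ₛ vertices T
    everywhere y = subst (y ∈ₛ_) (≡.sym T≡⊤) ∈⊤

    -- Two duplicate-free lists with the same members are permutations of each other.
    L↭ : L ↭ subtrees T
    L↭ = ∼bag⇒↭ (unique∧set⇒bag unique (subtrees-unique (separated e′))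
      (λ {S} → ⇔-trans (correct S) (⇔-sym (subtrees-correct e′ everywhere S))))

    total : totalOrder L + a * length L ≤ n * length L
    total rewrite sum-↭ (map⁺ ∣_∣ L↭) | ↭-length L↭ =
      subst (λ z → totalOrder (subtrees T) + a * length (subtrees T) ≤ z * length (subtrees T))
        size≡n
        (totalOrder-subtrees T (central .proj₂ .proj₁))

    n∸d≤ : n ∸ d ≤ 2 ^ suc x
    n∸d≤ = begin
      n ∸ d        ≤⟨ ∸-monoʳ-≤ n (long-path e′ diam) ⟩
      n ∸ δ        ≡⟨ cong (_∸ δ) size≡n ⟨
      suc E ∸ δ    ≡⟨ +-∸-assoc 1 δ≤E ⟩
      suc (E ∸ δ)  ≤⟨ log₂ (E ∸ δ) .proj₂ .proj₂ ⟩
      2 ^ suc x    ∎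
      where open ≤-Reasoning

    power : n * (n ∸ d) ^ 2 ≤ 2 ^ (a + 103)
    power = begin
      n * (n ∸ d) ^ 2
        ≤⟨ *-mono-≤ (subst (_≤ 2 ^ suc k) size≡n (log₂ E .proj₂ .proj₂)) (^-monoˡ-≤ 2 n∸d≤) ⟩
      2 ^ suc k * (2 ^ suc x) ^ 2     ≡⟨ cong (2 ^ suc k *_) (^-*-assoc 2 (suc x) 2) ⟩
      2 ^ suc k * 2 ^ (suc x * 2)     ≡⟨ ^-distribˡ-+-* 2 (suc k) (suc x * 2) ⟨
      2 ^ (suc k + suc x * 2)         ≤⟨ ^-monoʳ-≤ 2 exponent≤ ⟩
      2 ^ (a + 103)                   ∎
      where
      open ≤-Reasoning
      lem : ∀ k x → suc k + suc x * 2 ≡ 3 + (k + (x + x))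
      lem = solve-∀
      -- 103 is the 100 of `central-bound` plus 3 for rounding up: one for `n` and two for the
      -- square of `n ∸ d`.
      exponent≤ : suc k + suc x * 2 ≤ a + 103
      exponent≤ = ≤-trans (≤-reflexive (lem k x))
        (≤-trans (+-monoʳ-≤ 3 (central .proj₂ .proj₂)) (≤-reflexive (+-comm 103 a)))

-- Taking base-2 logarithms and dividing by `length L`, the number of subtrees, recovers the bound
-- on the mean. The product form stays within the natural numbers.
theorem4p7 : ∃[ C ] (∀ (n : ℕ) (G : Graph n) → 1 ≤ n → IsTree G →
    ∀ (d : ℕ) → IsDiameter G d →
    ∀ (L : List (Subset n)) → Unique L → (∀ S → (S ∈ L) ⇔ IsSubtree G S) →
    2 ^ totalOrder L * (n * (n ∸ d) ^ 2) ^ length L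
    ≤ 2 ^ ((n + C) * length L))
theorem4p7 = 103 , λ n G 1≤n tree d diam L unique correct →
  let a , total , power = mean-bound G 1≤n tree diam unique correct
  in exponentiate {n} {n * (n ∸ d) ^ 2} {length L} {a} {totalOrder L} 103 total power
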